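{- Let $(\mathcal{B},\mathbb{C},F,\mathbb{H})$ be a geminal category, with $\Box=\gamma_{\mathbb C}\circ F$. For any object $A\in\mathcal{B}$, there exists a morphism $Y_A:\mathbb{C}(F\Box A,FA)\to\Box A$ in $\mathcal B$ such that $$Y_A=\circ_{\mathbb C}\circ\langle \mathbb{H}_{1_{\mathbb C},FA}\circ Y_A,\ \mathrm{id}\rangle,$$ where $\langle \mathbb{H}_{1_{\mathbb C},FA}\circ Y_A,\mathrm{id}\rangle:\mathbb C(F\Box A,FA)\to\mathbb C(1_{\mathbb C},F\Box A)\times\mathbb C(F\Box A,FA)$, the morphism $\circ_{\mathbb C}:\mathbb C(1_{\mathbb C},F\Box A)\times\mathbb C(F\Box A,FA)\to\mathbb C(1_{\mathbb C},FA)=\Box A$ is composition in $\mathbb C$, and $\mathbb H_{1_{\mathbb C},FA}$ is regarded as a morphism $\Box A=\mathbb C(1_{\mathbb C},FA)\to(\Box\mathbb C)(\mathbb H1_{\mathbb C},\mathbb HFA)\cong\Box(\mathbb C(1_{\mathbb C},FA))=\Box\Box A=\mathbb C(1_{\mathbb C},F\Box A)$ via the canonical isomorphism.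
   Context: Internal categories. Let $\mathcal B$ be a locally small category with finite limits (a terminal object $1$ and pullbacks). A $\mathcal B$-internal category $\mathbb C$ has an object of objects $|\mathbb C|$, an object of morphisms $|\mathbb C^{\to}|$, morphisms $\mathrm{dom},\mathrm{cod}:|\mathbb C^\to|\to|\mathbb C|$, identities $e:|\mathbb C|\to|\mathbb C^\to|$ and a composition $\circ$ defined on the object of composable pairs (written in diagrammatic order), satisfying the usual axioms. An internal functor $\mathbb H:\mathbb C\to\mathbb D$ is a pair $|\mathbb H|:|\mathbb C|\to|\mathbb D|$, $|\mathbb H^\to|:|\mathbb C^\to|\to|\mathbb D^\to|$ commuting with this structure. A global object $X\in_1\mathbb C$ is a morphism $X:1\to|\mathbb C|$; $\mathbb HX=|\mathbb H|\circ X$. The hom-object $\mathbb C(X,Y)$ is the pullback of $\langle\mathrm{dom},\mathrm{cod}\rangle:|\mathbb C^\to|\to|\mathbb C|\times|\mathbb C|$ along $\langle X,Y\rangle:1\to|\mathbb C|\times|\mathbb C|$; its global elements (morphisms from $1$) are identified with global elements of $|\mathbb C^\to|$ with domain $X$ and codomain $Y$. Composition induces $\circ_{\mathbb C}:\mathbb C(X,Y)\times\mathbb C(Y,Z)\to\mathbb C(X,Z)$ and $\mathbb H$ induces $\mathbb H_{X,Y}:\mathbb C(X,Y)\to\mathbb D(\mathbb HX,\mathbb HY)$. The underlying category $\Gamma\mathbb C$ has global objects as objects and global elements of $\mathbb C(X,Y)$ as morphisms $X\to Y$; $\mathbb H$ induces a functor $\Gamma\mathbb H$. $\mathbb C$ has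 chosen finite limits if it is equipped with an internal chosen terminal object $1_{\mathbb C}\in_1\mathbb C$ and internal chosen pullbacks (given by morphisms of $\mathcal B$ expressing a choice of pullback squares and of mediating arrows, satisfying the evident internal equations); then $\Gamma\mathbb C$ has induced chosen finite limits. The global section functor is $\gamma_{\mathbb C}=\mathbb C(1_{\mathbb C},-):\Gamma\mathbb C\to\mathcal B$ (acting on morphisms by $\circ_{\mathbb C}$); it preserves finite limits. If $G:\mathcal B\to\mathcal B'$ preserves finite limits, $G\mathbb C$ is the $\mathcal B'$-internal category obtained by applying $G$ to all data of $\mathbb C$ (with induced chosen finite limits), $G\mathbb H$ is defined similarly for internal functors, and $G^{\#}_{\mathbb C}:\Gamma\mathbb C\to\Gamma G\mathbb C$ is the functor sending a global object $X$ to $1\cong G1\xrightarrow{GX}G|\mathbb C|$, and likewise on global morphisms; canonically $(G\mathbb C)(G^\#X,G^\#Y)\cong G(\mathbb C(X,Y))$. Pre-geminal category. It consists of: (I) a category $\mathcal B$ with chosen finite limits; (II) a $\mathcal B$-internal category $\mathbb C$ with chosen finite limits; (III) a functor $F:\mathcal B\to\Gamma\mathbb C$ strictly preserving the chosen finite limits; put $\Box=\gamma_{\mathbb C}\circ F:\mathcal B\to\mathcal B$, so $\Box A=\mathbb C(1_{\mathbb C},FA)$ (it preserves finite limits); (IV) a $\mathcal B$-internal functor $\mathbb H:\mathbb C\to\Box\mathbb C$ satisfying $\Gamma\mathbb H\circ F=F^{\#}_{\mathbb C}\circ F$, where the codomain $\Gamma F\mathbb C$ of $F^\#_{\mathbb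 C}$ is identified with $\Gamma\Box\mathbb C=\Gamma\gamma_{\mathbb C}F\mathbb C$ by the canonical isomorphism. Unfolded: with $u:1\cong\Box1$ the unique isomorphism, $|\mathbb H|\circ FA=\Box(FA)\circ u$ for every object $A$ of $\mathcal B$, and $|\mathbb H^\to|\circ Ff=\Box(Ff)\circ u$ for every morphism $f$ of $\mathcal B$, where $FA:1\to|\mathbb C|$ and $Ff:1\to|\mathbb C^\to|$. In particular $\mathbb HFA=\Box^\#FA$, whence a canonical isomorphism $(\Box\mathbb C)(\mathbb HFA,\mathbb HFB)\cong\Box(\mathbb C(FA,FB))$ for all $A,B\in\mathcal B$ (and $F1=1_{\mathbb C}$). Geminal category. It is a pre-geminal category such that $\mathbb H$ strictly preserves the chosen finite limits and $\Box\mathbb H\circ\mathbb H=\mathbb H^{\#}_{F\mathbb C}\circ\mathbb H$ as internal functors $\mathbb C\to\Box\Box\mathbb C$. Here $\mathbb H^\#_{F\mathbb C}:\Box\mathbb C=\gamma_{\mathbb C}F\mathbb C\to\Box\Box\mathbb C$ is the $\mathcal B$-internal functor given on objects by $\sigma_{|\mathbb C|}:\Box|\mathbb C|\to\Box\Box|\mathbb C|$ and on morphisms by $\sigma_{|\mathbb C^\to|}:\Box|\mathbb C^\to|\to\Box\Box|\mathbb C^\to|$, where for $A\in\mathcal B$, $\sigma_A$ is the composite $\Box A=\mathbb C(1_{\mathbb C},FA)\xrightarrow{\mathbb H_{1_{\mathbb C},FA}}(\Box\mathbb C)(\mathbb H1_{\mathbb C},\mathbb HFA)\cong\Box(\mathbb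 C(1_{\mathbb C},FA))=\Box\Box A$. -}

module Defs where

open import Level using (Level; _⊔_) renaming (suc to lsuc)
open import Relation.Binary using (Rel; IsEquivalence; Setoid)
import Relation.Binary.Reasoning.Setoid as SetoidReasoning

private
  variable
    o ℓ e o′ ℓ′ e′ : Level

------------------------------------------------------------------------
-- Categories, with hom-setoids

record Category (o ℓ e : Level) : Set (lsuc (o ⊔ ℓ ⊔ e)) where
  no-eta-equality
  constructor mkCategory
  infix  4 _≈_ _⇒_
  infixr 9 _∘_
  field
    Obj   : Set o
    _⇒_   : Obj → Obj → Set ℓ
    _≈_   : ∀ {A B} → Rel (A ⇒ B) e
    id    : ∀ {A} → A ⇒ A
    _∘_   : ∀ {A B C} → B ⇒ C → A ⇒ B → A ⇒ C
    equiv : ∀ {A B} → IsEquivalence (_≈_ {A} {B})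
    ∘-resp-≈ : ∀ {A B C} {f f′ : B ⇒ C} {g g′ : A ⇒ B} →
               f ≈ f′ → g ≈ g′ → f ∘ g ≈ f′ ∘ g′
    assoc : ∀ {A B C D} (f : C ⇒ D) (g : B ⇒ C) (h : A ⇒ B) →
            (f ∘ g) ∘ h ≈ f ∘ (g ∘ h)
    identityˡ : ∀ {A B} (f : A ⇒ B) → id ∘ f ≈ f
    identityʳ : ∀ {A B} (f : A ⇒ B) → f ∘ id ≈ f

  refl : ∀ {A B} {f : A ⇒ B} → f ≈ f
  refl = IsEquivalence.refl equiv

  sym : ∀ {A B} {f g : A ⇒ B} → f ≈ g → g ≈ f
  sym = IsEquivalence.sym equiv

  trans : ∀ {A B} {f g h : A ⇒ B} → f ≈ g → g ≈ h → f ≈ h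
  trans = IsEquivalence.trans equiv

  hom-setoid : Obj → Obj → Setoid ℓ e
  hom-setoid A B = record { Carrier = A ⇒ B ; _≈_ = _≈_ ; isEquivalence = equiv }

  infix 4 _≅_
  record _≅_ (A B : Obj) : Set (ℓ ⊔ e) where
    field
      to      : A ⇒ B
      from    : B ⇒ A
      to∘from : to ∘ from ≈ id
      from∘to : from ∘ to ≈ id

  private
    variable
      A B C D X : Obj

  ∘-respˡ : {f f′ : B ⇒ C} {g : A ⇒ B} → f ≈ f′ → f ∘ g ≈ f′ ∘ g
  ∘-respˡ p = ∘-resp-≈ p refl

  ∘-respʳ : {f : B ⇒ C} {g g′ : A ⇒ B} → g ≈ g′ → f ∘ g ≈ f ∘ g′
  ∘-respʳ p = ∘-resp-≈ refl p

  pullˡ : {f : B ⇒ C} {g : A ⇒ B} {h : A ⇒ C} {t : X ⇒ A} →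
          f ∘ g ≈ h → f ∘ (g ∘ t) ≈ h ∘ t
  pullˡ p = trans (sym (assoc _ _ _)) (∘-respˡ p)

  swapˡ : {f : B ⇒ C} {g : A ⇒ B} {f′ : D ⇒ C} {g′ : A ⇒ D} {t : X ⇒ A} →
          f ∘ g ≈ f′ ∘ g′ → f ∘ (g ∘ t) ≈ f′ ∘ (g′ ∘ t)
  swapˡ p = trans (pullˡ p) (assoc _ _ _)

  cancelˡ : {f : B ⇒ A} {g : A ⇒ B} {t : X ⇒ A} →
            f ∘ g ≈ id → f ∘ (g ∘ t) ≈ t
  cancelˡ p = trans (pullˡ p) (identityˡ _)
{-# INLINE mkCategory #-}

------------------------------------------------------------------------
-- Finite limits: a terminal object and pullbacks

module _ (𝓑 : Category o ℓ e) where
  open Category 𝓑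

  record IsTerminal (⊤ : Obj) : Set (o ⊔ ℓ ⊔ e) where
    no-eta-equality
    constructor mkIsTerminal
    field
      !        : ∀ {A} → A ⇒ ⊤
      !-unique : ∀ {A} (f : A ⇒ ⊤) → f ≈ !

    !-unique₂ : ∀ {A} {f g : A ⇒ ⊤} → f ≈ g
    !-unique₂ {f = f} {g} = trans (!-unique f) (sym (!-unique g))
  {-# INLINE mkIsTerminal #-}

  record IsPullback {A B X P : Obj} (f : A ⇒ X) (g : B ⇒ X)
                    (p₁ : P ⇒ A) (p₂ : P ⇒ B) : Set (o ⊔ ℓ ⊔ e) where
    no-eta-equality
    constructor mkIsPullback
    field
      commute : f ∘ p₁ ≈ g ∘ p₂
      pair    : ∀ {T} (h : T ⇒ A) (k : T ⇒ B) → f ∘ h ≈ g ∘ k → T ⇒ P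
      p₁∘pair : ∀ {T} (h : T ⇒ A) (k : T ⇒ B) (eq : f ∘ h ≈ g ∘ k) →
                p₁ ∘ pair h k eq ≈ h
      p₂∘pair : ∀ {T} (h : T ⇒ A) (k : T ⇒ B) (eq : f ∘ h ≈ g ∘ k) →
                p₂ ∘ pair h k eq ≈ k
      pair-unique : ∀ {T} (h : T ⇒ A) (k : T ⇒ B) (eq : f ∘ h ≈ g ∘ k)
                    (u : T ⇒ P) → p₁ ∘ u ≈ h → p₂ ∘ u ≈ k → u ≈ pair h k eq

    jointly-monic : ∀ {T} {u v : T ⇒ P} →
                    p₁ ∘ u ≈ p₁ ∘ v → p₂ ∘ u ≈ p₂ ∘ v → u ≈ v
    jointly-monic {u = u} {v} a b =
      trans (pair-unique _ _ eq u a b) (sym (pair-unique _ _ eq v refl refl))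
      where eq = swapˡ commute

    pair-cong : ∀ {T} {h h′ : T ⇒ A} {k k′ : T ⇒ B}
                {eq : f ∘ h ≈ g ∘ k} {eq′ : f ∘ h′ ≈ g ∘ k′} →
                h ≈ h′ → k ≈ k′ → pair h k eq ≈ pair h′ k′ eq′
    pair-cong a b = pair-unique _ _ _ _ (trans (p₁∘pair _ _ _) a) (trans (p₂∘pair _ _ _) b)

    pair-∘ : ∀ {S T} {h : T ⇒ A} {k : T ⇒ B} {t : S ⇒ T}
             {eq : f ∘ h ≈ g ∘ k} {eq′ : f ∘ (h ∘ t) ≈ g ∘ (k ∘ t)} →
             pair h k eq ∘ t ≈ pair (h ∘ t) (k ∘ t) eq′
    pair-∘ = pair-unique _ _ _ _ (pullˡ (p₁∘pair _ _ _)) (pullˡ (p₂∘pair _ _ _))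
  {-# INLINE mkIsPullback #-}

  record Pullback {A B X : Obj} (f : A ⇒ X) (g : B ⇒ X) : Set (o ⊔ ℓ ⊔ e) where
    no-eta-equality
    constructor mkPullback
    field
      {P} : Obj
      p₁  : P ⇒ A
      p₂  : P ⇒ B
      isPullback : IsPullback f g p₁ p₂
    open IsPullback isPullback public
  {-# INLINE mkPullback #-}

  record FiniteLimits : Set (o ⊔ ℓ ⊔ e) where
    no-eta-equality
    constructor mkFiniteLimits
    infixr 7 _×_
    field
      ⊤          : Obj
      isTerminal : IsTerminal ⊤
      pullback   : ∀ {A B X} (f : A ⇒ X) (g : B ⇒ X) → Pullback f g
    open IsTerminal isTerminal public

    product : ∀ A B → Pullback (! {A}) (! {B})
    product A B = pullback ! !

    _×_ : Obj → Obj → Obj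
    A × B = Pullback.P (product A B)

    π₁ : ∀ {A B} → A × B ⇒ A
    π₁ = Pullback.p₁ (product _ _)

    π₂ : ∀ {A B} → A × B ⇒ B
    π₂ = Pullback.p₂ (product _ _)

    ⟨_,_⟩ : ∀ {T A B} → T ⇒ A → T ⇒ B → T ⇒ A × B
    ⟨ f , g ⟩ = Pullback.pair (product _ _) f g !-unique₂

    π₁∘⟨⟩ : ∀ {T A B} (f : T ⇒ A) (g : T ⇒ B) → π₁ ∘ ⟨ f , g ⟩ ≈ f
    π₁∘⟨⟩ f g = Pullback.p₁∘pair (product _ _) f g !-unique₂

    π₂∘⟨⟩ : ∀ {T A B} (f : T ⇒ A) (g : T ⇒ B) → π₂ ∘ ⟨ f , g ⟩ ≈ g
    π₂∘⟨⟩ f g = Pullback.p₂∘pair (product _ _) f g !-unique₂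

    ⟨⟩-unique₂ : ∀ {T A B} {u v : T ⇒ A × B} →
                 π₁ ∘ u ≈ π₁ ∘ v → π₂ ∘ u ≈ π₂ ∘ v → u ≈ v
    ⟨⟩-unique₂ = Pullback.jointly-monic (product _ _)
  {-# INLINE mkFiniteLimits #-}

------------------------------------------------------------------------
-- Functors

record Functor (𝓐 : Category o ℓ e) (𝓑 : Category o′ ℓ′ e′) :
               Set (o ⊔ ℓ ⊔ e ⊔ o′ ⊔ ℓ′ ⊔ e′) where
  no-eta-equality
  constructor mkFunctor
  private
    module A = Category 𝓐
    module B = Category 𝓑
  field
    F₀ : A.Obj → B.Obj
    F₁ : ∀ {X Y} → X A.⇒ Y → F₀ X B.⇒ F₀ Y
    F-resp-≈     : ∀ {X Y} {f g : X A.⇒ Y} → f A.≈ g → F₁ f B.≈ F₁ g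
    identity     : ∀ {X} → F₁ (A.id {X}) B.≈ B.id
    homomorphism : ∀ {X Y Z} (g : Y A.⇒ Z) (f : X A.⇒ Y) →
                   F₁ (g A.∘ f) B.≈ F₁ g B.∘ F₁ f

  resp-square : ∀ {X Y Y′ Z} {f : Y A.⇒ Z} {g : X A.⇒ Y} {h : Y′ A.⇒ Z} {k : X A.⇒ Y′} →
                f A.∘ g A.≈ h A.∘ k → F₁ f B.∘ F₁ g B.≈ F₁ h B.∘ F₁ k
  resp-square p =
    B.trans (B.sym (homomorphism _ _)) (B.trans (F-resp-≈ p) (homomorphism _ _))

  resp-triangle : ∀ {X Y Z} {f : Y A.⇒ Z} {g : X A.⇒ Y} {h : X A.⇒ Z} →
                  f A.∘ g A.≈ h → F₁ f B.∘ F₁ g B.≈ F₁ h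
  resp-triangle p = B.trans (B.sym (homomorphism _ _)) (F-resp-≈ p)
{-# INLINE mkFunctor #-}

_∘F_ : ∀ {o″ ℓ″ e″} {𝓐 : Category o ℓ e} {𝓑 : Category o′ ℓ′ e′} {𝓒 : Category o″ ℓ″ e″} →
       Functor 𝓑 𝓒 → Functor 𝓐 𝓑 → Functor 𝓐 𝓒
_∘F_ {𝓒 = 𝓒} G F = record
  { F₀ = λ X → G.F₀ (F.F₀ X)
  ; F₁ = λ f → G.F₁ (F.F₁ f)
  ; F-resp-≈ = λ p → G.F-resp-≈ (F.F-resp-≈ p)
  ; identity = trans (G.F-resp-≈ F.identity) G.identity
  ; homomorphism = λ g f → trans (G.F-resp-≈ (F.homomorphism g f)) (G.homomorphism _ _)
  }
  where
    module G = Functor G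
    module F = Functor F
    open Category 𝓒

record PreservesFiniteLimits {𝓐 : Category o ℓ e} {𝓑 : Category o′ ℓ′ e′}
                             (G : Functor 𝓐 𝓑) : Set (o ⊔ ℓ ⊔ e ⊔ o′ ⊔ ℓ′ ⊔ e′) where
  no-eta-equality
  constructor mkPreservesFiniteLimits
  open Category 𝓐
  open Functor G
  field
    terminal : ∀ {⊤} → IsTerminal 𝓐 ⊤ → IsTerminal 𝓑 (F₀ ⊤)
    pullback : ∀ {A B X P} {f : A ⇒ X} {g : B ⇒ X} {p₁ : P ⇒ A} {p₂ : P ⇒ B} →
               IsPullback 𝓐 f g p₁ p₂ → IsPullback 𝓑 (F₁ f) (F₁ g) (F₁ p₁) (F₁ p₂)
{-# INLINE mkPreservesFiniteLimits #-}

∘F-preserves : ∀ {o″ ℓ″ e″} {𝓐 : Category o ℓ e} {𝓑 : Category o′ ℓ′ e′}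
               {𝓒 : Category o″ ℓ″ e″} {G : Functor 𝓑 𝓒} {F : Functor 𝓐 𝓑} →
               PreservesFiniteLimits G → PreservesFiniteLimits F →
               PreservesFiniteLimits (G ∘F F)
∘F-preserves g f = record
  { terminal = λ t → G.terminal (F.terminal t)
  ; pullback = λ p → G.pullback (F.pullback p)
  }
  where
    module G = PreservesFiniteLimits g
    module F = PreservesFiniteLimits f

-- All finite limits are preserved as soon as some choice of them is.
module _ {𝓐 : Category o ℓ e} {𝓑 : Category o′ ℓ′ e′} (G : Functor 𝓐 𝓑) (L : FiniteLimits 𝓐) where
  private
    module A = Category 𝓐
    module L = FiniteLimits L
  open Category 𝓑
  open Functor G

  preserves-terminal : IsTerminal 𝓑 (F₀ L.⊤) → ∀ {⊤} → IsTerminal 𝓐 ⊤ → IsTerminal 𝓑 (F₀ ⊤)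
  preserves-terminal t i = record
    { ! = F₁ (IsTerminal.! i) ∘ T.!
    ; !-unique = λ f → trans
        (sym (cancelˡ (trans (resp-triangle (IsTerminal.!-unique₂ i)) identity)))
        (∘-respʳ (T.!-unique (F₁ L.! ∘ f)))
    }
    where module T = IsTerminal t

  preserves-pullback : ∀ {A B X P} {f : A A.⇒ X} {g : B A.⇒ X} {p₁ : P A.⇒ A} {p₂ : P A.⇒ B} →
    IsPullback 𝓑 (F₁ f) (F₁ g) (F₁ (Pullback.p₁ (L.pullback f g))) (F₁ (Pullback.p₂ (L.pullback f g))) →
    IsPullback 𝓐 f g p₁ p₂ → IsPullback 𝓑 (F₁ f) (F₁ g) (F₁ p₁) (F₁ p₂)
  preserves-pullback {P = P} {f} {g} {p₁} {p₂} r i = record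
    { commute = resp-square I.commute
    ; pair = λ h k eq → F₁ ψ ∘ R.pair h k eq
    ; p₁∘pair = λ h k eq →
        trans (pullˡ (resp-triangle (I.p₁∘pair _ _ _))) (R.p₁∘pair h k eq)
    ; p₂∘pair = λ h k eq →
        trans (pullˡ (resp-triangle (I.p₂∘pair _ _ _))) (R.p₂∘pair h k eq)
    ; pair-unique = λ h k eq u a b → trans
        (sym (cancelˡ (trans (resp-triangle ψφ) identity)))
        (∘-respʳ (R.pair-unique h k eq (F₁ φ ∘ u)
          (trans (pullˡ (resp-triangle (Q.p₁∘pair _ _ _))) a)
          (trans (pullˡ (resp-triangle (Q.p₂∘pair _ _ _))) b)))
    }
    where
      module I = IsPullback i
      module R = IsPullback r
      module Q = Pullback (L.pullback f g)

      φ : P A.⇒ Q.P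
      φ = Q.pair p₁ p₂ I.commute

      ψ : Q.P A.⇒ P
      ψ = I.pair Q.p₁ Q.p₂ Q.commute

      ψφ : ψ A.∘ φ A.≈ A.id
      ψφ = I.jointly-monic
        (A.trans (A.pullˡ (I.p₁∘pair _ _ _)) (A.trans (Q.p₁∘pair _ _ _) (A.sym (A.identityʳ _))))
        (A.trans (A.pullˡ (I.p₂∘pair _ _ _)) (A.trans (Q.p₂∘pair _ _ _) (A.sym (A.identityʳ _))))

  preserves-chosen :
    IsTerminal 𝓑 (F₀ L.⊤) →
    (∀ {A B X} (f : A A.⇒ X) (g : B A.⇒ X) →
       IsPullback 𝓑 (F₁ f) (F₁ g) (F₁ (Pullback.p₁ (L.pullback f g))) (F₁ (Pullback.p₂ (L.pullback f g)))) →
    PreservesFiniteLimits G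
  preserves-chosen t p = record
    { terminal = preserves-terminal t
    ; pullback = λ i → preserves-pullback (p _ _) i
    }

------------------------------------------------------------------------
-- Internal categories

-- The object of composable pairs is carried as a specified pullback, not
-- forced to be the one chosen in 𝓑, so that a functor preserving finite
-- limits can be applied to all of the data verbatim.
-- Laws are stated for generalised elements f : T ⇒ C₁.

record InternalCategory (𝓑 : Category o ℓ e) : Set (o ⊔ ℓ ⊔ e) where
  no-eta-equality
  constructor mkInternalCategory
  open Category 𝓑
  field
    C₀ C₁      : Obj
    dom cod    : C₁ ⇒ C₀
    ident      : C₀ ⇒ C₁
    composable : Pullback 𝓑 cod dom

  module C₂ = Pullback composable
  C₂ : Obj
  C₂ = C₂.P

  field
    comp : C₂ ⇒ C₁

  -- Diagrammatic order.
  compose : ∀ {T} (f g : T ⇒ C₁) → cod ∘ f ≈ dom ∘ g → T ⇒ C₁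
  compose f g eq = comp ∘ C₂.pair f g eq

  field
    dom-ident : dom ∘ ident ≈ id
    cod-ident : cod ∘ ident ≈ id
    dom-comp  : dom ∘ comp ≈ dom ∘ C₂.p₁
    cod-comp  : cod ∘ comp ≈ cod ∘ C₂.p₂
    compose-identˡ : ∀ {T} (f : T ⇒ C₁) (eq : cod ∘ (ident ∘ (dom ∘ f)) ≈ dom ∘ f) →
                     compose (ident ∘ (dom ∘ f)) f eq ≈ f
    compose-identʳ : ∀ {T} (f : T ⇒ C₁) (eq : cod ∘ f ≈ dom ∘ (ident ∘ (cod ∘ f))) →
                     compose f (ident ∘ (cod ∘ f)) eq ≈ f
    compose-assoc  : ∀ {T} (f g h : T ⇒ C₁)
                     (fg : cod ∘ f ≈ dom ∘ g) (gh : cod ∘ g ≈ dom ∘ h)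
                     (eq : cod ∘ compose f g fg ≈ dom ∘ h)
                     (eq′ : cod ∘ f ≈ dom ∘ compose g h gh) →
                     compose (compose f g fg) h eq ≈ compose f (compose g h gh) eq′

  private
    variable
      S T : Obj
      f f′ g g′ : T ⇒ C₁

  dom-compose : {eq : cod ∘ f ≈ dom ∘ g} → dom ∘ compose f g eq ≈ dom ∘ f
  dom-compose = trans (swapˡ dom-comp) (∘-respʳ (C₂.p₁∘pair _ _ _))

  cod-compose : {eq : cod ∘ f ≈ dom ∘ g} → cod ∘ compose f g eq ≈ cod ∘ g
  cod-compose = trans (swapˡ cod-comp) (∘-respʳ (C₂.p₂∘pair _ _ _))

  compose-cong : {eq : cod ∘ f ≈ dom ∘ g} {eq′ : cod ∘ f′ ≈ dom ∘ g′} →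
                 f ≈ f′ → g ≈ g′ → compose f g eq ≈ compose f′ g′ eq′
  compose-cong a b = ∘-respʳ (C₂.pair-cong a b)

  compose-∘ : {t : S ⇒ T} {eq : cod ∘ f ≈ dom ∘ g} {eq′ : cod ∘ (f ∘ t) ≈ dom ∘ (g ∘ t)} →
              compose f g eq ∘ t ≈ compose (f ∘ t) (g ∘ t) eq′
  compose-∘ = trans (assoc _ _ _) (∘-respʳ C₂.pair-∘)

  comp-∘ : {t : T ⇒ C₂} {eq : cod ∘ (C₂.p₁ ∘ t) ≈ dom ∘ (C₂.p₂ ∘ t)} →
           comp ∘ t ≈ compose (C₂.p₁ ∘ t) (C₂.p₂ ∘ t) eq
  comp-∘ = ∘-respʳ (C₂.pair-unique _ _ _ _ refl refl)
{-# INLINE mkInternalCategory #-}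

record InternalFunctor {𝓑 : Category o ℓ e} (ℂ 𝔻 : InternalCategory 𝓑) : Set (o ⊔ ℓ ⊔ e) where
  no-eta-equality
  constructor mkInternalFunctor
  open Category 𝓑
  private
    module C = InternalCategory ℂ
    module D = InternalCategory 𝔻
  field
    H₀ : C.C₀ ⇒ D.C₀
    H₁ : C.C₁ ⇒ D.C₁
    dom-H   : D.dom ∘ H₁ ≈ H₀ ∘ C.dom
    cod-H   : D.cod ∘ H₁ ≈ H₀ ∘ C.cod
    ident-H : H₁ ∘ C.ident ≈ D.ident ∘ H₀

  composable-H : ∀ {T} {f g : T ⇒ C.C₁} → C.cod ∘ f ≈ C.dom ∘ g →
                 D.cod ∘ (H₁ ∘ f) ≈ D.dom ∘ (H₁ ∘ g)
  composable-H eq = trans (swapˡ cod-H) (trans (∘-respʳ eq) (sym (swapˡ dom-H)))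

  field
    comp-H : H₁ ∘ C.comp ≈ D.compose (H₁ ∘ C.C₂.p₁) (H₁ ∘ C.C₂.p₂) (composable-H C.C₂.commute)

  compose-H : ∀ {T} {f g : T ⇒ C.C₁} {eq : C.cod ∘ f ≈ C.dom ∘ g}
              {eq′ : D.cod ∘ (H₁ ∘ f) ≈ D.dom ∘ (H₁ ∘ g)} →
              H₁ ∘ C.compose f g eq ≈ D.compose (H₁ ∘ f) (H₁ ∘ g) eq′
  compose-H {f = f} {g} {eq} = begin
    H₁ ∘ (C.comp ∘ C.C₂.pair f g eq)  ≈⟨ pullˡ comp-H ⟩
    D.compose _ _ _ ∘ C.C₂.pair f g eq
      ≈⟨ D.compose-∘ {eq′ = trans (∘-respʳ (assoc _ _ _))
           (trans (composable-H (swapˡ C.C₂.commute)) (sym (∘-respʳ (assoc _ _ _))))} ⟩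
    D.compose _ _ _
      ≈⟨ D.compose-cong (trans (assoc _ _ _) (∘-respʳ (C.C₂.p₁∘pair _ _ _)))
                        (trans (assoc _ _ _) (∘-respʳ (C.C₂.p₂∘pair _ _ _))) ⟩
    D.compose (H₁ ∘ f) (H₁ ∘ g) _  ∎
    where open SetoidReasoning (hom-setoid _ _)
{-# INLINE mkInternalFunctor #-}

module _ {𝓑 : Category o ℓ e} where
  open Category 𝓑

  infixr 9 _∘I_
  infix  4 _≈I_

  _∘I_ : {ℂ 𝔻 𝔼 : InternalCategory 𝓑} →
         InternalFunctor 𝔻 𝔼 → InternalFunctor ℂ 𝔻 → InternalFunctor ℂ 𝔼
  _∘I_ {ℂ} {𝔻} {𝔼} K H = record
    { H₀ = K.H₀ ∘ H.H₀
    ; H₁ = K.H₁ ∘ H.H₁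
    ; dom-H = trans (swapˡ K.dom-H) (trans (∘-respʳ H.dom-H) (sym (assoc _ _ _)))
    ; cod-H = trans (swapˡ K.cod-H) (trans (∘-respʳ H.cod-H) (sym (assoc _ _ _)))
    ; ident-H = trans (assoc _ _ _) (trans (∘-respʳ H.ident-H) (swapˡ K.ident-H))
    ; comp-H = trans (assoc _ _ _) (trans (∘-respʳ H.comp-H)
        (trans (K.compose-H {eq′ = K.composable-H (H.composable-H C.C₂.commute)})
               (E.compose-cong (sym (assoc _ _ _)) (sym (assoc _ _ _)))))
    }
    where
      module K = InternalFunctor K
      module H = InternalFunctor H
      module C = InternalCategory ℂ
      module E = InternalCategory 𝔼

  record _≈I_ {ℂ 𝔻 : InternalCategory 𝓑} (H K : InternalFunctor ℂ 𝔻) : Set e where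
    private
      module H = InternalFunctor H
      module K = InternalFunctor K
    field
      ≈₀ : H.H₀ ≈ K.H₀
      ≈₁ : H.H₁ ≈ K.H₁

------------------------------------------------------------------------
-- Internal chosen finite limits

module _ {𝓑 : Category o ℓ e} (L : FiniteLimits 𝓑) (ℂ : InternalCategory 𝓑) where
  open Category 𝓑
  open FiniteLimits L using (⊤; !; !-unique₂)
  open InternalCategory ℂ

  record ChosenTerminal : Set (o ⊔ ℓ ⊔ e) where
    no-eta-equality
    constructor mkChosenTerminal
    field
      one         : ⊤ ⇒ C₀
      bang        : C₀ ⇒ C₁
      dom-bang    : dom ∘ bang ≈ id
      cod-bang    : cod ∘ bang ≈ one ∘ !
      bang-unique : ∀ {T} (f : T ⇒ C₁) → cod ∘ f ≈ one ∘ ! → f ≈ bang ∘ (dom ∘ f)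

    bang-unique₂ : ∀ {T} {f g : T ⇒ C₁} → cod ∘ f ≈ one ∘ ! → cod ∘ g ≈ one ∘ ! →
                   dom ∘ f ≈ dom ∘ g → f ≈ g
    bang-unique₂ a b c =
      trans (bang-unique _ a) (trans (∘-respʳ c) (sym (bang-unique _ b)))
  {-# INLINE mkChosenTerminal #-}

module _ {𝓑 : Category o ℓ e} (ℂ : InternalCategory 𝓑) where
  open Category 𝓑
  open InternalCategory ℂ

  record ChosenPullbacks : Set (o ⊔ ℓ ⊔ e) where
    no-eta-equality
    constructor mkChosenPullbacks
    field
      cospans : Pullback 𝓑 cod cod
      squares : Pullback 𝓑 comp comp

    module Cospan = Pullback cospans
    module Square = Pullback squares

    Cospan : Obj
    Cospan = Cospan.P

    Square : Obj
    Square = Square.P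

    -- A generic element of Square is a commutative square
    -- top ⨾ right = left ⨾ bottom over the cospan (right , bottom).
    top : Square ⇒ C₁
    top = C₂.p₁ ∘ Square.p₁

    right : Square ⇒ C₁
    right = C₂.p₂ ∘ Square.p₁

    left : Square ⇒ C₁
    left = C₂.p₁ ∘ Square.p₂

    bottom : Square ⇒ C₁
    bottom = C₂.p₂ ∘ Square.p₂

    cod-right-bottom : cod ∘ right ≈ cod ∘ bottom
    cod-right-bottom =
      trans (sym (swapˡ cod-comp)) (trans (∘-respʳ Square.commute) (swapˡ cod-comp))

    cospanOf : Square ⇒ Cospan
    cospanOf = Cospan.pair right bottom cod-right-bottom

    field
      proj₁ proj₂ : Cospan ⇒ C₁
      dom-proj    : dom ∘ proj₁ ≈ dom ∘ proj₂
      cod-proj₁   : cod ∘ proj₁ ≈ dom ∘ Cospan.p₁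
      cod-proj₂   : cod ∘ proj₂ ≈ dom ∘ Cospan.p₂
      proj-square : compose proj₁ Cospan.p₁ cod-proj₁ ≈ compose proj₂ Cospan.p₂ cod-proj₂

    apex : Cospan ⇒ C₀
    apex = dom ∘ proj₁

    field
      med       : Square ⇒ C₁
      dom-med   : dom ∘ med ≈ dom ∘ top
      cod-med   : cod ∘ med ≈ apex ∘ cospanOf
      med-proj₁ : (eq : cod ∘ med ≈ dom ∘ (proj₁ ∘ cospanOf)) →
                  compose med (proj₁ ∘ cospanOf) eq ≈ top
      med-proj₂ : (eq : cod ∘ med ≈ dom ∘ (proj₂ ∘ cospanOf)) →
                  compose med (proj₂ ∘ cospanOf) eq ≈ left
      med-unique : ∀ {T} (s : T ⇒ Square) (m : T ⇒ C₁)
                   (eq₁ : cod ∘ m ≈ dom ∘ (proj₁ ∘ (cospanOf ∘ s)))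
                   (eq₂ : cod ∘ m ≈ dom ∘ (proj₂ ∘ (cospanOf ∘ s))) →
                   compose m (proj₁ ∘ (cospanOf ∘ s)) eq₁ ≈ top ∘ s →
                   compose m (proj₂ ∘ (cospanOf ∘ s)) eq₂ ≈ left ∘ s →
                   m ≈ med ∘ s

    module _ {T} (c : T ⇒ Cospan) where
      dom-proj∘ : dom ∘ (proj₁ ∘ c) ≈ dom ∘ (proj₂ ∘ c)
      dom-proj∘ = swapˡ dom-proj

      cod-proj₁∘ : cod ∘ (proj₁ ∘ c) ≈ dom ∘ (Cospan.p₁ ∘ c)
      cod-proj₁∘ = swapˡ cod-proj₁

      cod-proj₂∘ : cod ∘ (proj₂ ∘ c) ≈ dom ∘ (Cospan.p₂ ∘ c)
      cod-proj₂∘ = swapˡ cod-proj₂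

      proj-square∘ : compose (proj₁ ∘ c) (Cospan.p₁ ∘ c) cod-proj₁∘ ≈
                     compose (proj₂ ∘ c) (Cospan.p₂ ∘ c) cod-proj₂∘
      proj-square∘ = trans (sym compose-∘) (trans (∘-respˡ proj-square) compose-∘)

      module _ (h k : T ⇒ C₁)
               (h-eq : cod ∘ h ≈ dom ∘ (Cospan.p₁ ∘ c))
               (k-eq : cod ∘ k ≈ dom ∘ (Cospan.p₂ ∘ c))
               (sq : compose h (Cospan.p₁ ∘ c) h-eq ≈ compose k (Cospan.p₂ ∘ c) k-eq) where

        square : T ⇒ Square
        square = Square.pair (C₂.pair h _ h-eq) (C₂.pair k _ k-eq) sq

        top-square : top ∘ square ≈ h
        top-square = trans (assoc _ _ _) (trans (∘-respʳ (Square.p₁∘pair _ _ _)) (C₂.p₁∘pair _ _ _))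

        left-square : left ∘ square ≈ k
        left-square = trans (assoc _ _ _) (trans (∘-respʳ (Square.p₂∘pair _ _ _)) (C₂.p₁∘pair _ _ _))

        right-square : right ∘ square ≈ Cospan.p₁ ∘ c
        right-square = trans (assoc _ _ _) (trans (∘-respʳ (Square.p₁∘pair _ _ _)) (C₂.p₂∘pair _ _ _))

        bottom-square : bottom ∘ square ≈ Cospan.p₂ ∘ c
        bottom-square = trans (assoc _ _ _) (trans (∘-respʳ (Square.p₂∘pair _ _ _)) (C₂.p₂∘pair _ _ _))

        cospanOf-square : cospanOf ∘ square ≈ c
        cospanOf-square = Cospan.jointly-monic
          (trans (pullˡ (Cospan.p₁∘pair _ _ _)) right-square)
          (trans (pullˡ (Cospan.p₂∘pair _ _ _)) bottom-square)

        mediate : T ⇒ C₁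
        mediate = med ∘ square

        dom-mediate : dom ∘ mediate ≈ dom ∘ h
        dom-mediate = trans (swapˡ dom-med) (∘-respʳ top-square)

        cod-mediate₁ : cod ∘ mediate ≈ dom ∘ (proj₁ ∘ c)
        cod-mediate₁ = trans (swapˡ cod-med) (trans (∘-respʳ cospanOf-square) (assoc _ _ _))

        cod-mediate₂ : cod ∘ mediate ≈ dom ∘ (proj₂ ∘ c)
        cod-mediate₂ = trans cod-mediate₁ dom-proj∘

        mediate-proj₁ : {eq : cod ∘ mediate ≈ dom ∘ (proj₁ ∘ c)} →
                        compose mediate (proj₁ ∘ c) eq ≈ h
        mediate-proj₁ = trans
          (compose-cong {eq′ = trans (swapˡ eq) refl} refl
            (trans (∘-respʳ (sym cospanOf-square)) (sym (assoc _ _ _))))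
          (trans (sym (compose-∘ {eq = eq})) (trans (∘-respˡ (med-proj₁ eq)) top-square))
          where eq = trans cod-med (assoc _ _ _)

        mediate-proj₂ : {eq : cod ∘ mediate ≈ dom ∘ (proj₂ ∘ c)} →
                        compose mediate (proj₂ ∘ c) eq ≈ k
        mediate-proj₂ = trans
          (compose-cong {eq′ = trans (swapˡ eq) refl} refl
            (trans (∘-respʳ (sym cospanOf-square)) (sym (assoc _ _ _))))
          (trans (sym (compose-∘ {eq = eq})) (trans (∘-respˡ (med-proj₂ eq)) left-square))
          where eq = trans cod-med (trans (assoc _ _ _) (swapˡ dom-proj))

        mediate-unique : (m : T ⇒ C₁)
                         (eq₁ : cod ∘ m ≈ dom ∘ (proj₁ ∘ c))
                         (eq₂ : cod ∘ m ≈ dom ∘ (proj₂ ∘ c)) →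
                         compose m (proj₁ ∘ c) eq₁ ≈ h →
                         compose m (proj₂ ∘ c) eq₂ ≈ k → m ≈ mediate
        mediate-unique m eq₁ eq₂ a b = med-unique square m
          (trans eq₁ (∘-respʳ (∘-respʳ (sym cospanOf-square))))
          (trans eq₂ (∘-respʳ (∘-respʳ (sym cospanOf-square))))
          (trans (compose-cong refl (∘-respʳ cospanOf-square)) (trans a (sym top-square)))
          (trans (compose-cong refl (∘-respʳ cospanOf-square)) (trans b (sym left-square)))
  {-# INLINE mkChosenPullbacks #-}

record ChosenFiniteLimits {𝓑 : Category o ℓ e} (L : FiniteLimits 𝓑)
                          (ℂ : InternalCategory 𝓑) : Set (o ⊔ ℓ ⊔ e) where
  no-eta-equality
  constructor mkChosenFiniteLimits
  field
    chosenTerminal  : ChosenTerminal L ℂ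
    chosenPullbacks : ChosenPullbacks ℂ
  open ChosenTerminal chosenTerminal public
  open ChosenPullbacks chosenPullbacks public
{-# INLINE mkChosenFiniteLimits #-}

-- Preservation of bang and med follows from their uniqueness.
record StrictlyPreservesLimits {𝓑 : Category o ℓ e} {L : FiniteLimits 𝓑}
         {ℂ 𝔻 : InternalCategory 𝓑} (K : ChosenFiniteLimits L ℂ) (M : ChosenFiniteLimits L 𝔻)
         (ℍ : InternalFunctor ℂ 𝔻) : Set e where
  open Category 𝓑
  open InternalFunctor ℍ
  private
    module C = InternalCategory ℂ
    module D = InternalCategory 𝔻
    module K = ChosenFiniteLimits K
    module M = ChosenFiniteLimits M

  cospan-H : K.Cospan ⇒ M.Cospan
  cospan-H = M.Cospan.pair (H₁ ∘ K.Cospan.p₁) (H₁ ∘ K.Cospan.p₂)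
    (trans (swapˡ cod-H) (trans (∘-respʳ K.Cospan.commute) (sym (swapˡ cod-H))))

  field
    one-H   : H₀ ∘ K.one ≈ M.one
    proj₁-H : H₁ ∘ K.proj₁ ≈ M.proj₁ ∘ cospan-H
    proj₂-H : H₁ ∘ K.proj₂ ≈ M.proj₂ ∘ cospan-H

------------------------------------------------------------------------
-- Applying a finite-limit-preserving functor to an internal category

module Image {𝓑 : Category o ℓ e} {𝓑′ : Category o′ ℓ′ e′}
             (L : FiniteLimits 𝓑) (L′ : FiniteLimits 𝓑′)
             (G : Functor 𝓑 𝓑′) (lex : PreservesFiniteLimits G) where
  private
    module B = Category 𝓑
    module L = FiniteLimits L
    module L′ = FiniteLimits L′
    module P = PreservesFiniteLimits lex
  open Category 𝓑′
  open Functor G renaming (F₀ to G₀; F₁ to G₁; F-resp-≈ to G-resp; identity to G-id)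

  imagePullback : ∀ {A B X} {f : A B.⇒ X} {g : B B.⇒ X} →
                  Pullback 𝓑 f g → Pullback 𝓑′ (G₁ f) (G₁ g)
  imagePullback p = record { isPullback = P.pullback (Pullback.isPullback p) }

  module _ (ℂ : InternalCategory 𝓑) where
    private
      module C = InternalCategory ℂ
      module GC₂ = Pullback (imagePullback C.composable)

      com : ∀ {T} (f g : T ⇒ G₀ C.C₁) → G₁ C.cod ∘ f ≈ G₁ C.dom ∘ g → T ⇒ G₀ C.C₁
      com f g eq = G₁ C.comp ∘ GC₂.pair f g eq

      -- The image of a composite, at a generalised element t.
      G-com : ∀ {S T} {f g : S B.⇒ C.C₁} {eq : C.cod B.∘ f B.≈ C.dom B.∘ g} {t : T ⇒ G₀ S}
              {f′ g′ : T ⇒ G₀ C.C₁} {eq′ : G₁ C.cod ∘ f′ ≈ G₁ C.dom ∘ g′} →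
              G₁ f ∘ t ≈ f′ → G₁ g ∘ t ≈ g′ →
              G₁ (C.compose f g eq) ∘ t ≈ com f′ g′ eq′
      G-com a b = trans (∘-respˡ (homomorphism _ _)) (trans (assoc _ _ _)
        (∘-respʳ (GC₂.pair-unique _ _ _ _
          (trans (pullˡ (resp-triangle (C.C₂.p₁∘pair _ _ _))) a)
          (trans (pullˡ (resp-triangle (C.C₂.p₂∘pair _ _ _))) b))))

      G∘ : ∀ {X Y Z T} {f : Y B.⇒ Z} {g : X B.⇒ Y} {t : T ⇒ G₀ X} →
           G₁ (f B.∘ g) ∘ t ≈ G₁ f ∘ (G₁ g ∘ t)
      G∘ = trans (∘-respˡ (homomorphism _ _)) (assoc _ _ _)

      G-idˡ : ∀ {X T} {t : T ⇒ G₀ X} → G₁ B.id ∘ t ≈ t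
      G-idˡ = trans (∘-respˡ G-id) (identityˡ _)

      module _ {T} (f g h : T ⇒ G₀ C.C₁)
               (fg : G₁ C.cod ∘ f ≈ G₁ C.dom ∘ g) (gh : G₁ C.cod ∘ g ≈ G₁ C.dom ∘ h) where
        module T = Pullback (L.pullback (C.cod B.∘ C.C₂.p₂) C.dom)
        module GT = Pullback (imagePullback (L.pullback (C.cod B.∘ C.C₂.p₂) C.dom))

        a b c : T.P B.⇒ C.C₁
        a = C.C₂.p₁ B.∘ T.p₁
        b = C.C₂.p₂ B.∘ T.p₁
        c = T.p₂

        ab : C.cod B.∘ a B.≈ C.dom B.∘ b
        ab = B.swapˡ C.C₂.commute

        bc : C.cod B.∘ b B.≈ C.dom B.∘ c
        bc = B.trans (B.sym (B.assoc _ _ _)) T.commute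

        triple-eq : G₁ (C.cod B.∘ C.C₂.p₂) ∘ GC₂.pair f g fg ≈ G₁ C.dom ∘ h
        triple-eq = trans G∘ (trans (∘-respʳ (GC₂.p₂∘pair f g fg)) gh)

        triple : T ⇒ G₀ T.P
        triple = GT.pair (GC₂.pair f g fg) h triple-eq

        a-triple : G₁ a ∘ triple ≈ f
        a-triple = trans G∘ (trans (∘-respʳ (GT.p₁∘pair _ h triple-eq)) (GC₂.p₁∘pair f g fg))

        b-triple : G₁ b ∘ triple ≈ g
        b-triple = trans G∘ (trans (∘-respʳ (GT.p₁∘pair _ h triple-eq)) (GC₂.p₂∘pair f g fg))

        c-triple : G₁ c ∘ triple ≈ h
        c-triple = GT.p₂∘pair _ h triple-eq

        com-assoc : {eq : G₁ C.cod ∘ com f g fg ≈ G₁ C.dom ∘ h}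
                    {eq′ : G₁ C.cod ∘ f ≈ G₁ C.dom ∘ com g h gh} →
                    com (com f g fg) h eq ≈ com f (com g h gh) eq′
        com-assoc = trans
          (sym (G-com {eq = B.trans C.cod-compose bc} (G-com {eq = ab} a-triple b-triple) c-triple))
          (trans (∘-respˡ (G-resp (C.compose-assoc a b c ab bc _ _)))
                 (G-com {eq = B.trans ab (B.sym C.dom-compose)} a-triple
                        (G-com {eq = bc} b-triple c-triple)))

    image : InternalCategory 𝓑′
    image = record
      { C₀ = G₀ C.C₀
      ; C₁ = G₀ C.C₁
      ; dom = G₁ C.dom
      ; cod = G₁ C.cod
      ; ident = G₁ C.ident
      ; composable = imagePullback C.composable
      ; comp = G₁ C.comp
      ; dom-ident = trans (resp-triangle C.dom-ident) G-id
      ; cod-ident = trans (resp-triangle C.cod-ident) G-id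
      ; dom-comp = resp-square C.dom-comp
      ; cod-comp = resp-square C.cod-comp
      ; compose-identˡ = λ f eq →
          trans (sym (G-com {eq = B.cancelˡ C.cod-ident}
                            (trans G∘ (∘-respʳ (trans G∘ (∘-respʳ G-idˡ)))) G-idˡ))
                (trans (∘-respˡ (G-resp (C.compose-identˡ B.id _))) G-idˡ)
      ; compose-identʳ = λ f eq →
          trans (sym (G-com {eq = B.sym (B.cancelˡ C.dom-ident)} G-idˡ
                            (trans G∘ (∘-respʳ (trans G∘ (∘-respʳ G-idˡ))))))
                (trans (∘-respˡ (G-resp (C.compose-identʳ B.id _))) G-idˡ)
      ; compose-assoc = λ f g h fg gh _ _ → com-assoc f g h fg gh
      }

    private
      module GC = InternalCategory image

    compose-image : ∀ {S T} {f g : S B.⇒ C.C₁} {eq : C.cod B.∘ f B.≈ C.dom B.∘ g} {t : T ⇒ G₀ S}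
                    {f′ g′ : T ⇒ G₀ C.C₁} {eq′ : GC.cod ∘ f′ ≈ GC.dom ∘ g′} →
                    G₁ f ∘ t ≈ f′ → G₁ g ∘ t ≈ g′ →
                    G₁ (C.compose f g eq) ∘ t ≈ GC.compose f′ g′ eq′
    compose-image = G-com

    imageTerminal : ChosenTerminal L ℂ → ChosenTerminal L′ image
    imageTerminal K = record
      { one = G₁ K.one ∘ u
      ; bang = G₁ K.bang
      ; dom-bang = trans (resp-triangle K.dom-bang) G-id
      ; cod-bang = trans (resp-square K.cod-bang)
          (trans (∘-respʳ G⊤.!-unique₂) (sym (assoc _ _ _)))
      ; bang-unique = λ f eq →
          let module S = Pullback (L.pullback C.cod K.one)
              module GS = IsPullback (P.pullback S.isPullback)
              t = GS.pair f (u ∘ L′.!) (trans eq (assoc _ _ _))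
              f-t = GS.p₁∘pair f (u ∘ L′.!) (trans eq (assoc _ _ _))
          in trans (sym f-t)
             (trans (∘-respˡ (G-resp (K.bang-unique S.p₁
                       (B.trans S.commute (B.∘-respʳ L.!-unique₂)))))
             (trans G∘ (∘-respʳ (trans G∘ (∘-respʳ f-t)))))
      }
      where
        module K = ChosenTerminal K
        module G⊤ = IsTerminal (P.terminal L.isTerminal)
        u : L′.⊤ ⇒ G₀ L.⊤
        u = G⊤.!

    imagePullbacks : ChosenPullbacks ℂ → ChosenPullbacks image
    imagePullbacks K = record
      { cospans = imagePullback K.cospans
      ; squares = imagePullback K.squares
      ; proj₁ = G₁ K.proj₁
      ; proj₂ = G₁ K.proj₂
      ; dom-proj = resp-square K.dom-proj
      ; cod-proj₁ = resp-square K.cod-proj₁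
      ; cod-proj₂ = resp-square K.cod-proj₂
      ; proj-square = trans (sym (G-compose K.cod-proj₁))
          (trans (G-resp K.proj-square) (G-compose K.cod-proj₂))
      ; med = G₁ K.med
      ; dom-med = trans (resp-square K.dom-med) (∘-respʳ (homomorphism _ _))
      ; cod-med = trans (resp-square K.cod-med)
          (∘-resp-≈ (homomorphism _ _) G-cospanOf)
      ; med-proj₁ = λ eq → trans
          (GC.compose-cong {eq′ = resp-square eq₁} refl
            (trans (∘-respʳ (sym G-cospanOf)) (sym (homomorphism _ _))))
          (trans (sym (G-compose eq₁))
            (trans (G-resp (K.med-proj₁ eq₁)) (homomorphism _ _)))
      ; med-proj₂ = λ eq → trans
          (GC.compose-cong {eq′ = resp-square eq₂} refl
            (trans (∘-respʳ (sym G-cospanOf)) (sym (homomorphism _ _))))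
          (trans (sym (G-compose eq₂))
            (trans (G-resp (K.med-proj₂ eq₂)) (homomorphism _ _)))
      ; med-unique = med-unique
      }
      where
        module K = ChosenPullbacks K
        module GCospan = Pullback (imagePullback K.cospans)
        module GSquare = Pullback (imagePullback K.squares)

        G-compose : ∀ {S} {f g : S B.⇒ C.C₁} (eq : C.cod B.∘ f B.≈ C.dom B.∘ g) →
                    G₁ (C.compose f g eq) ≈ GC.compose (G₁ f) (G₁ g) (resp-square eq)
        G-compose eq = trans (sym (identityʳ _)) (G-com (identityʳ _) (identityʳ _))

        G-cod-right-bottom : G₁ C.cod ∘ (G₁ C.C₂.p₂ ∘ G₁ K.Square.p₁) ≈
                             G₁ C.cod ∘ (G₁ C.C₂.p₂ ∘ G₁ K.Square.p₂)
        G-cod-right-bottom =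
          trans (sym (swapˡ GC.cod-comp))
                (trans (∘-respʳ GSquare.commute) (swapˡ GC.cod-comp))

        G-cospanOf : G₁ K.cospanOf ≈ GCospan.pair _ _ G-cod-right-bottom
        G-cospanOf = GCospan.pair-unique _ _ _ _
          (trans (resp-triangle (K.Cospan.p₁∘pair _ _ _)) (homomorphism _ _))
          (trans (resp-triangle (K.Cospan.p₂∘pair _ _ _)) (homomorphism _ _))

        eq₁ : C.cod B.∘ K.med B.≈ C.dom B.∘ (K.proj₁ B.∘ K.cospanOf)
        eq₁ = B.trans K.cod-med (B.assoc _ _ _)

        eq₂ : C.cod B.∘ K.med B.≈ C.dom B.∘ (K.proj₂ B.∘ K.cospanOf)
        eq₂ = B.trans eq₁ (B.swapˡ K.dom-proj)

        -- The generic pair of a cospan c and an arrow m into its apex, and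
        -- the square it generates.
        module M = Pullback (L.pullback C.cod (C.dom B.∘ K.proj₁))

        n₁ : C.cod B.∘ M.p₁ B.≈ C.dom B.∘ (K.proj₁ B.∘ M.p₂)
        n₁ = B.trans M.commute (B.assoc _ _ _)

        n₂ : C.cod B.∘ M.p₁ B.≈ C.dom B.∘ (K.proj₂ B.∘ M.p₂)
        n₂ = B.trans n₁ (K.dom-proj∘ M.p₂)

        h k : M.P B.⇒ C.C₁
        h = C.compose M.p₁ (K.proj₁ B.∘ M.p₂) n₁
        k = C.compose M.p₁ (K.proj₂ B.∘ M.p₂) n₂

        h-eq : C.cod B.∘ h B.≈ C.dom B.∘ (K.Cospan.p₁ B.∘ M.p₂)
        h-eq = B.trans C.cod-compose (K.cod-proj₁∘ M.p₂)

        k-eq : C.cod B.∘ k B.≈ C.dom B.∘ (K.Cospan.p₂ B.∘ M.p₂)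
        k-eq = B.trans C.cod-compose (K.cod-proj₂∘ M.p₂)

        sq : C.compose h (K.Cospan.p₁ B.∘ M.p₂) h-eq B.≈ C.compose k (K.Cospan.p₂ B.∘ M.p₂) k-eq
        sq = B.trans
          (C.compose-assoc _ _ _ n₁ (K.cod-proj₁∘ M.p₂) h-eq (B.trans n₁ (B.sym C.dom-compose)))
          (B.trans
            (C.compose-cong {eq′ = B.trans n₂ (B.sym C.dom-compose)} B.refl (K.proj-square∘ M.p₂))
            (B.sym (C.compose-assoc _ _ _ n₂ (K.cod-proj₂∘ M.p₂) k-eq _)))

        sq-M : M.P B.⇒ K.Square
        sq-M = K.square M.p₂ h k h-eq k-eq sq

        generic : M.p₁ B.≈ K.med B.∘ sq-M
        generic = K.mediate-unique M.p₂ h k h-eq k-eq sq M.p₁ n₁ n₂ B.refl B.refl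

        image-edge : ∀ {T} {p : K.Square B.⇒ C.C₂} {q : C.C₂ B.⇒ C.C₁} {r : M.P B.⇒ C.C₁}
                     {t : T ⇒ G₀ M.P} →
                     (q B.∘ p) B.∘ sq-M B.≈ r →
                     G₁ q ∘ (G₁ p ∘ (G₁ sq-M ∘ t)) ≈ G₁ r ∘ t
        image-edge eq = trans (∘-respʳ (sym G∘))
          (trans (sym G∘) (∘-respˡ (G-resp (B.trans (B.sym (B.assoc _ _ _)) eq))))

        cospanOf′ : G₀ K.Square ⇒ G₀ K.Cospan
        cospanOf′ = GCospan.pair _ _ G-cod-right-bottom

        module _ {T} (s : T ⇒ G₀ K.Square) (m : T ⇒ G₀ C.C₁)
                 (e₁ : G₁ C.cod ∘ m ≈ G₁ C.dom ∘ (G₁ K.proj₁ ∘ (cospanOf′ ∘ s)))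
                 (e₂ : G₁ C.cod ∘ m ≈ G₁ C.dom ∘ (G₁ K.proj₂ ∘ (cospanOf′ ∘ s)))
                 (m₁ : GC.compose m (G₁ K.proj₁ ∘ (cospanOf′ ∘ s)) e₁ ≈
                       (G₁ C.C₂.p₁ ∘ G₁ K.Square.p₁) ∘ s)
                 (m₂ : GC.compose m (G₁ K.proj₂ ∘ (cospanOf′ ∘ s)) e₂ ≈
                       (G₁ C.C₂.p₁ ∘ G₁ K.Square.p₂) ∘ s) where

          module GM = IsPullback (P.pullback M.isPullback)

          t : T ⇒ G₀ M.P
          t = GM.pair m (cospanOf′ ∘ s) (trans e₁ (sym G∘))

          m-t : G₁ M.p₁ ∘ t ≈ m
          m-t = GM.p₁∘pair _ _ _

          c-t : G₁ M.p₂ ∘ t ≈ cospanOf′ ∘ s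
          c-t = GM.p₂∘pair _ _ _

          s-t : G₁ sq-M ∘ t ≈ s
          s-t = GSquare.jointly-monic
            (GC₂.jointly-monic
              (trans (image-edge (K.top-square M.p₂ h k h-eq k-eq sq))
                (trans (G-com m-t (trans G∘ (∘-respʳ c-t))) (trans m₁ (assoc _ _ _))))
              (trans (image-edge (K.right-square M.p₂ h k h-eq k-eq sq))
                (trans G∘ (trans (∘-respʳ c-t)
                  (trans (pullˡ (GCospan.p₁∘pair _ _ _)) (assoc _ _ _))))))
            (GC₂.jointly-monic
              (trans (image-edge (K.left-square M.p₂ h k h-eq k-eq sq))
                (trans (G-com m-t (trans G∘ (∘-respʳ c-t))) (trans m₂ (assoc _ _ _))))
              (trans (image-edge (K.bottom-square M.p₂ h k h-eq k-eq sq))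
                (trans G∘ (trans (∘-respʳ c-t)
                  (trans (pullˡ (GCospan.p₂∘pair _ _ _)) (assoc _ _ _))))))

          med-unique : m ≈ G₁ K.med ∘ s
          med-unique = trans (sym m-t) (trans (∘-respˡ (G-resp generic)) (trans G∘ (∘-respʳ s-t)))

    imageLimits : ChosenFiniteLimits L ℂ → ChosenFiniteLimits L′ image
    imageLimits K = record
      { chosenTerminal = imageTerminal K.chosenTerminal
      ; chosenPullbacks = imagePullbacks K.chosenPullbacks
      }
      where module K = ChosenFiniteLimits K

  imageFunctor : {ℂ 𝔻 : InternalCategory 𝓑} →
                 InternalFunctor ℂ 𝔻 → InternalFunctor (image ℂ) (image 𝔻)
  imageFunctor {ℂ} {𝔻} ℍ = record
    { H₀ = G₁ H.H₀
    ; H₁ = G₁ H.H₁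
    ; dom-H = resp-square H.dom-H
    ; cod-H = resp-square H.cod-H
    ; ident-H = resp-square H.ident-H
    ; comp-H = trans (resp-square H.comp-H) (∘-respʳ (GD₂.pair-unique _ _ _ _
        (trans (resp-triangle (D.C₂.p₁∘pair _ _ _)) (homomorphism _ _))
        (trans (resp-triangle (D.C₂.p₂∘pair _ _ _)) (homomorphism _ _))))
    }
    where
      module H = InternalFunctor ℍ
      module D = InternalCategory 𝔻
      module GD₂ = Pullback (imagePullback D.composable)

------------------------------------------------------------------------
-- Global objects, hom-objects and the underlying category

module Global {𝓑 : Category o ℓ e} (L : FiniteLimits 𝓑) (ℂ : InternalCategory 𝓑) where
  open Category 𝓑
  open FiniteLimits L
  open InternalCategory ℂ

  GlobalObject : Set ℓ
  GlobalObject = ⊤ ⇒ C₀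

  private
    variable
      T : Obj
      X Y Z X′ Y′ : GlobalObject

  hom : (X Y : GlobalObject) → Pullback 𝓑 ⟨ dom , cod ⟩ ⟨ X , Y ⟩
  hom X Y = pullback ⟨ dom , cod ⟩ ⟨ X , Y ⟩

  Hom : GlobalObject → GlobalObject → Obj
  Hom X Y = Pullback.P (hom X Y)

  arrow : Hom X Y ⇒ C₁
  arrow {X} {Y} = Pullback.p₁ (hom X Y)

  opaque
    dom-arrow : dom ∘ arrow {X} {Y} ≈ X ∘ !
    dom-arrow {X} {Y} = begin
      dom ∘ arrow                      ≈⟨ pullˡ (π₁∘⟨⟩ _ _) ⟨
      π₁ ∘ (⟨ dom , cod ⟩ ∘ arrow)     ≈⟨ ∘-respʳ (Pullback.commute (hom X Y)) ⟩
      π₁ ∘ (⟨ X , Y ⟩ ∘ _)             ≈⟨ pullˡ (π₁∘⟨⟩ _ _) ⟩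
      X ∘ _                            ≈⟨ ∘-respʳ (!-unique _) ⟩
      X ∘ !                            ∎
      where open SetoidReasoning (hom-setoid _ _)

    cod-arrow : cod ∘ arrow {X} {Y} ≈ Y ∘ !
    cod-arrow {X} {Y} = begin
      cod ∘ arrow                      ≈⟨ pullˡ (π₂∘⟨⟩ _ _) ⟨
      π₂ ∘ (⟨ dom , cod ⟩ ∘ arrow)     ≈⟨ ∘-respʳ (Pullback.commute (hom X Y)) ⟩
      π₂ ∘ (⟨ X , Y ⟩ ∘ _)             ≈⟨ pullˡ (π₂∘⟨⟩ _ _) ⟩
      Y ∘ _                            ≈⟨ ∘-respʳ (!-unique _) ⟩
      Y ∘ !                            ∎
      where open SetoidReasoning (hom-setoid _ _)

    dom-arrow∘ : {t : T ⇒ Hom X Y} → dom ∘ (arrow ∘ t) ≈ X ∘ !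
    dom-arrow∘ = trans (swapˡ dom-arrow) (∘-respʳ !-unique₂)

    cod-arrow∘ : {t : T ⇒ Hom X Y} → cod ∘ (arrow ∘ t) ≈ Y ∘ !
    cod-arrow∘ = trans (swapˡ cod-arrow) (∘-respʳ !-unique₂)

    hom-eq : (f : T ⇒ C₁) → dom ∘ f ≈ X ∘ ! → cod ∘ f ≈ Y ∘ ! →
             ⟨ dom , cod ⟩ ∘ f ≈ ⟨ X , Y ⟩ ∘ !
    hom-eq f d c = ⟨⟩-unique₂
      (trans (pullˡ (π₁∘⟨⟩ _ _)) (trans d (sym (pullˡ (π₁∘⟨⟩ _ _)))))
      (trans (pullˡ (π₂∘⟨⟩ _ _)) (trans c (sym (pullˡ (π₂∘⟨⟩ _ _)))))

  element : (f : T ⇒ C₁) → dom ∘ f ≈ X ∘ ! → cod ∘ f ≈ Y ∘ ! → T ⇒ Hom X Y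
  element {X = X} {Y} f d c = Pullback.pair (hom X Y) f ! (hom-eq f d c)

  arrow-element : {f : T ⇒ C₁} {d : dom ∘ f ≈ X ∘ !} {c : cod ∘ f ≈ Y ∘ !} →
                  arrow ∘ element f d c ≈ f
  arrow-element {X = X} {Y} = Pullback.p₁∘pair (hom X Y) _ _ _

  arrow-monic : {s t : T ⇒ Hom X Y} → arrow ∘ s ≈ arrow ∘ t → s ≈ t
  arrow-monic {X = X} {Y} p = Pullback.jointly-monic (hom X Y) p !-unique₂

  castHom : X ≈ X′ → Y ≈ Y′ → Hom X Y ⇒ Hom X′ Y′
  castHom p q = element arrow (trans dom-arrow (∘-respˡ p)) (trans cod-arrow (∘-respˡ q))

  opaque
    meet : {s : T ⇒ Hom X Y} {t : T ⇒ Hom Y Z} → cod ∘ (arrow ∘ s) ≈ dom ∘ (arrow ∘ t)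
    meet = trans cod-arrow∘ (sym dom-arrow∘)

  composeHom : (X Y Z : GlobalObject) → Hom X Y × Hom Y Z ⇒ Hom X Z
  composeHom X Y Z = element (compose (arrow ∘ π₁) (arrow ∘ π₂) meet)
    (trans dom-compose dom-arrow∘) (trans cod-compose cod-arrow∘)

  arrow-composeHom : {s : T ⇒ Hom X Y} {t : T ⇒ Hom Y Z}
                     {eq : cod ∘ (arrow ∘ s) ≈ dom ∘ (arrow ∘ t)} →
                     arrow ∘ (composeHom X Y Z ∘ ⟨ s , t ⟩) ≈ compose (arrow ∘ s) (arrow ∘ t) eq
  arrow-composeHom = trans (pullˡ arrow-element)
    (trans (compose-∘ {eq′ = trans (∘-respʳ (assoc _ _ _)) (trans meet (∘-respʳ (sym (assoc _ _ _))))})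
      (compose-cong (trans (assoc _ _ _) (∘-respʳ (π₁∘⟨⟩ _ _)))
                    (trans (assoc _ _ _) (∘-respʳ (π₂∘⟨⟩ _ _)))))

  -- Global elements of Hom X Y, identified with global elements of C₁ having
  -- domain X and codomain Y.
  record GlobalArrow (X Y : GlobalObject) : Set (ℓ ⊔ e) where
    no-eta-equality
    constructor mkGlobalArrow
    field
      arr     : ⊤ ⇒ C₁
      dom-arr : dom ∘ arr ≈ X
      cod-arr : cod ∘ arr ≈ Y
  {-# INLINE mkGlobalArrow #-}

  open GlobalArrow public

  private opaque
    name-dom : (f : GlobalArrow X Y) → dom ∘ arr f ≈ X ∘ !
    name-dom f = trans (dom-arr f) (trans (sym (identityʳ _)) (∘-respʳ (!-unique _)))

    name-cod : (f : GlobalArrow X Y) → cod ∘ arr f ≈ Y ∘ !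
    name-cod f = trans (cod-arr f) (trans (sym (identityʳ _)) (∘-respʳ (!-unique _)))

  name : GlobalArrow X Y → ⊤ ⇒ Hom X Y
  name f = element (arr f) (name-dom f) (name-cod f)

  Γ : Category ℓ (ℓ ⊔ e) e
  Γ = record
    { Obj = GlobalObject
    ; _⇒_ = GlobalArrow
    ; _≈_ = λ f g → arr f ≈ arr g
    ; id = λ {X} → record
        { arr = ident ∘ X
        ; dom-arr = cancelˡ dom-ident
        ; cod-arr = cancelˡ cod-ident
        }
    ; _∘_ = λ g f → record
        { arr = compose (arr f) (arr g) (trans (cod-arr f) (sym (dom-arr g)))
        ; dom-arr = trans dom-compose (dom-arr f)
        ; cod-arr = trans cod-compose (cod-arr g)
        }
    ; equiv = record { refl = refl ; sym = sym ; trans = trans }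
    ; ∘-resp-≈ = λ p q → compose-cong q p
    ; assoc = λ f g h → sym (compose-assoc _ _ _ _ _ _ _)
    ; identityˡ = λ f → trans
        (compose-cong {eq′ = sym (cancelˡ dom-ident)} refl (∘-respʳ (sym (cod-arr f))))
        (compose-identʳ _ _)
    ; identityʳ = λ f → trans
        (compose-cong {eq′ = cancelˡ cod-ident} (∘-respʳ (sym (dom-arr f))) refl)
        (compose-identˡ _ _)
    }

open Global using (Γ) public

-- Equality of functors into an underlying category: objects, being global
-- elements, are compared by the equality of 𝓑.
record EqualFunctors {𝓐 : Category o ℓ e} {𝓑 : Category o′ ℓ′ e′} (L : FiniteLimits 𝓑)
         (ℂ : InternalCategory 𝓑) (F G : Functor 𝓐 (Γ L ℂ)) : Set (o ⊔ ℓ ⊔ e′) where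
  private
    module A = Category 𝓐
    module F = Functor F
    module G = Functor G
  open Category 𝓑
  open Global L ℂ
  field
    ≈₀ : ∀ X → F.F₀ X ≈ G.F₀ X
    ≈₁ : ∀ {X Y} (f : X A.⇒ Y) → arr (F.F₁ f) ≈ arr (G.F₁ f)

module _ {𝓑 : Category o ℓ e} (L : FiniteLimits 𝓑) {ℂ 𝔻 : InternalCategory 𝓑}
         (ℍ : InternalFunctor ℂ 𝔻) where
  open Category 𝓑
  open FiniteLimits L
  open InternalFunctor ℍ
  private
    module C = InternalCategory ℂ
    module D = InternalCategory 𝔻
    module GC = Global L ℂ
    module GD = Global L 𝔻

  Γ-functor : Functor (Γ L ℂ) (Γ L 𝔻)
  Γ-functor = record
    { F₀ = λ X → H₀ ∘ X
    ; F₁ = λ f → record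
        { arr = H₁ ∘ GC.arr f
        ; dom-arr = trans (swapˡ dom-H) (∘-respʳ (GC.dom-arr f))
        ; cod-arr = trans (swapˡ cod-H) (∘-respʳ (GC.cod-arr f))
        }
    ; F-resp-≈ = ∘-respʳ
    ; identity = swapˡ ident-H
    ; homomorphism = λ g f → compose-H
    }

  mapHom : (X Y : GC.GlobalObject) → GC.Hom X Y ⇒ GD.Hom (H₀ ∘ X) (H₀ ∘ Y)
  mapHom X Y = GD.element (H₁ ∘ GC.arrow)
    (trans (swapˡ dom-H) (trans (∘-respʳ GC.dom-arrow) (sym (assoc _ _ _))))
    (trans (swapˡ cod-H) (trans (∘-respʳ GC.cod-arrow) (sym (assoc _ _ _))))


------------------------------------------------------------------------
-- The underlying category has finite limits, and global sections preserve them

module Sections {𝓑 : Category o ℓ e} (L : FiniteLimits 𝓑) {ℂ : InternalCategory 𝓑}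
                (K : ChosenFiniteLimits L ℂ) where
  open Category 𝓑
  open FiniteLimits L
  open InternalCategory ℂ
  open Global L ℂ hiding (Γ)
  open ChosenFiniteLimits K using (one; bang; dom-bang; cod-bang; bang-unique₂; proj₁; proj₂;
    apex; module Cospan; Cospan; dom-proj; cod-proj₁∘; cod-proj₂∘; proj-square∘; mediate;
    dom-mediate; cod-mediate₁; cod-mediate₂; mediate-proj₁; mediate-proj₂; mediate-unique)

  private
    at⊤ : ∀ {A} {h : ⊤ ⇒ A} → h ∘ ! ≈ h
    at⊤ = trans (∘-respʳ !-unique₂) (identityʳ _)

    at! : ∀ {A S T} {h : ⊤ ⇒ A} {s : S ⇒ ⊤} {t : T ⇒ S} → (h ∘ s) ∘ t ≈ h ∘ !
    at! = trans (assoc _ _ _) (∘-respʳ (!-unique _))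

    variable
      T : Obj
      X Y Z : GlobalObject

  private
    module ΓPullback {X Y Z : GlobalObject} (f : GlobalArrow X Z) (g : GlobalArrow Y Z) where
      cospan : ⊤ ⇒ Cospan
      cospan = Cospan.pair (arr f) (arr g) (trans (cod-arr f) (sym (cod-arr g)))

      cospan₁ : Cospan.p₁ ∘ cospan ≈ arr f
      cospan₁ = Cospan.p₁∘pair _ _ _

      cospan₂ : Cospan.p₂ ∘ cospan ≈ arr g
      cospan₂ = Cospan.p₂∘pair _ _ _

      P : GlobalObject
      P = apex ∘ cospan

      p₁ : GlobalArrow P X
      p₁ = record
        { arr = proj₁ ∘ cospan
        ; dom-arr = sym (assoc _ _ _)
        ; cod-arr = trans (cod-proj₁∘ cospan) (trans (∘-respʳ cospan₁) (dom-arr f))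
        }

      p₂ : GlobalArrow P Y
      p₂ = record
        { arr = proj₂ ∘ cospan
        ; dom-arr = sym (trans (∘-respˡ dom-proj) (assoc _ _ _))
        ; cod-arr = trans (cod-proj₂∘ cospan) (trans (∘-respʳ cospan₂) (dom-arr g))
        }

  Γ-terminal : IsTerminal (Γ L ℂ) one
  Γ-terminal = record
    { ! = λ {X} → record
        { arr = bang ∘ X
        ; dom-arr = cancelˡ dom-bang
        ; cod-arr = trans (pullˡ cod-bang) (trans at! at⊤)
        }
    ; !-unique = λ f → bang-unique₂
        (trans (cod-arr f) (sym at⊤))
        (trans (pullˡ cod-bang) at!)
        (trans (dom-arr f) (sym (cancelˡ dom-bang)))
    }

  Γ-isPullback : (f : GlobalArrow X Z) (g : GlobalArrow Y Z) →
                 IsPullback (Γ L ℂ) f g (ΓPullback.p₁ f g) (ΓPullback.p₂ f g)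
  Γ-isPullback f g = record
    { commute = trans (compose-cong refl (sym cospan₁))
        (trans (proj-square∘ cospan) (compose-cong refl cospan₂))
    ; pair = λ h k eq → record
        { arr = mediate cospan (arr h) (arr k) (h-eq h) (k-eq k) (sq h k eq)
        ; dom-arr = trans (dom-mediate cospan _ _ _ _ _) (dom-arr h)
        ; cod-arr = trans (cod-mediate₁ cospan _ _ _ _ _) (sym (assoc _ _ _))
        }
    ; p₁∘pair = λ h k eq → mediate-proj₁ cospan _ _ (h-eq h) (k-eq k) (sq h k eq)
    ; p₂∘pair = λ h k eq → mediate-proj₂ cospan _ _ (h-eq h) (k-eq k) (sq h k eq)
    ; pair-unique = λ h k eq m a b →
        mediate-unique cospan _ _ (h-eq h) (k-eq k) (sq h k eq) (arr m) _ _ a b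
    }
    where
      open ΓPullback f g

      h-eq : ∀ {W} (h : GlobalArrow W _) → cod ∘ arr h ≈ dom ∘ (Cospan.p₁ ∘ cospan)
      h-eq h = trans (cod-arr h) (trans (sym (dom-arr f)) (∘-respʳ (sym cospan₁)))

      k-eq : ∀ {W} (k : GlobalArrow W _) → cod ∘ arr k ≈ dom ∘ (Cospan.p₂ ∘ cospan)
      k-eq k = trans (cod-arr k) (trans (sym (dom-arr g)) (∘-respʳ (sym cospan₂)))

      sq : ∀ {W} (h : GlobalArrow W _) (k : GlobalArrow W _) →
           compose (arr h) (arr f) (trans (cod-arr h) (sym (dom-arr f))) ≈
           compose (arr k) (arr g) (trans (cod-arr k) (sym (dom-arr g))) →
           compose (arr h) (Cospan.p₁ ∘ cospan) (h-eq h) ≈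
           compose (arr k) (Cospan.p₂ ∘ cospan) (k-eq k)
      sq h k eq = trans (compose-cong refl cospan₁) (trans eq (compose-cong refl (sym cospan₂)))

  Γ-pullback : (f : GlobalArrow X Z) (g : GlobalArrow Y Z) → Pullback (Γ L ℂ) f g
  Γ-pullback f g = record
    { P = ΓPullback.P f g
    ; p₁ = ΓPullback.p₁ f g
    ; p₂ = ΓPullback.p₂ f g
    ; isPullback = Γ-isPullback f g
    }

  Γ-limits : FiniteLimits (Γ L ℂ)
  Γ-limits = record
    { ⊤ = one
    ; isTerminal = Γ-terminal
    ; pullback = Γ-pullback
    }

  γ₀ : GlobalObject → Obj
  γ₀ X = Hom one X

  γ-meet : (f : GlobalArrow X Y) {s : T ⇒ γ₀ X} → cod ∘ (arrow ∘ s) ≈ dom ∘ (arr f ∘ !)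
  γ-meet f = trans cod-arrow∘ (sym (pullˡ (dom-arr f)))

  -- Opaque only to keep type checking fast; arrow-γ characterises γ₁.
  opaque
    γ₁ : GlobalArrow X Y → γ₀ X ⇒ γ₀ Y
    γ₁ {X} {Y} f = composeHom one X Y ∘ ⟨ id , name f ∘ ! ⟩

    arrow-γ : (f : GlobalArrow X Y) {s : T ⇒ γ₀ X} →
              arrow ∘ (γ₁ f ∘ s) ≈ compose (arrow ∘ s) (arr f ∘ !) (γ-meet f)
    arrow-γ f {s} = trans (pullˡ (arrow-composeHom {eq = trans cod-arrow∘ (sym dom-arrow∘)}))
      (trans (compose-∘ {eq′ = trans (trans (∘-respʳ (assoc _ _ _)) cod-arrow∘)
                                     (sym (trans (∘-respʳ (assoc _ _ _)) dom-arrow∘))})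
        (compose-cong (∘-respˡ (identityʳ _))
          (trans (∘-respˡ (pullˡ arrow-element)) at!)))

  γ-meet′ : (f : GlobalArrow X Y) → cod ∘ arrow {one} {X} ≈ dom ∘ (arr f ∘ !)
  γ-meet′ f = trans cod-arrow (sym (pullˡ (dom-arr f)))

  arrow-γ′ : (f : GlobalArrow X Y) → arrow ∘ γ₁ f ≈ compose arrow (arr f ∘ !) (γ-meet′ f)
  arrow-γ′ f = trans (∘-respʳ (sym (identityʳ _)))
    (trans (arrow-γ f) (compose-cong (identityʳ _) refl))

  γ : Functor (Γ L ℂ) 𝓑
  γ = record
    { F₀ = γ₀
    ; F₁ = γ₁
    ; F-resp-≈ = λ {_} {_} {f} {g} p → arrow-monic
        (trans (arrow-γ′ f) (trans (compose-cong refl (∘-respˡ p)) (sym (arrow-γ′ g))))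
    ; identity = arrow-monic (trans (arrow-γ′ (Category.id (Γ L ℂ)))
        (trans (compose-cong {eq′ = sym (cancelˡ dom-ident)} refl
                 (trans (assoc _ _ _) (∘-respʳ (sym cod-arrow))))
        (trans (compose-identʳ _ _) (sym (identityʳ _)))))
    ; homomorphism = λ g f →
        let fg = trans (pullˡ (cod-arr f)) (sym (pullˡ (dom-arr g))) in
        arrow-monic (trans (arrow-γ′ (Category._∘_ (Γ L ℂ) g f))
        (trans (compose-cong {eq′ = trans (γ-meet′ f) (sym dom-compose)} refl (compose-∘ {eq′ = fg}))
        (trans (sym (compose-assoc _ _ _ (γ-meet′ f) fg (trans cod-compose fg) _))
        (trans (compose-cong {eq′ = γ-meet g} (sym (arrow-γ′ f)) refl)
               (sym (arrow-γ g))))))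
    }

  private
    module γPullback {X Y Z : GlobalObject} (f : GlobalArrow X Z) (g : GlobalArrow Y Z)
                     {T : Obj} (s : T ⇒ γ₀ X) (t : T ⇒ γ₀ Y) (eq : γ₁ f ∘ s ≈ γ₁ g ∘ t) where
      open ΓPullback f g using (cospan; cospan₁; cospan₂)
      open Pullback (FiniteLimits.pullback Γ-limits f g) using (P; p₁; p₂)

      c : T ⇒ Cospan
      c = cospan ∘ !

      f-c : Cospan.p₁ ∘ c ≈ arr f ∘ !
      f-c = pullˡ cospan₁

      g-c : Cospan.p₂ ∘ c ≈ arr g ∘ !
      g-c = pullˡ cospan₂

      s-eq : cod ∘ (arrow ∘ s) ≈ dom ∘ (Cospan.p₁ ∘ c)
      s-eq = trans (γ-meet f) (∘-respʳ (sym f-c))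

      t-eq : cod ∘ (arrow ∘ t) ≈ dom ∘ (Cospan.p₂ ∘ c)
      t-eq = trans (γ-meet g) (∘-respʳ (sym g-c))

      sq : compose (arrow ∘ s) (Cospan.p₁ ∘ c) s-eq ≈ compose (arrow ∘ t) (Cospan.p₂ ∘ c) t-eq
      sq = trans (compose-cong refl f-c)
        (trans (sym (arrow-γ f)) (trans (∘-respʳ eq)
        (trans (arrow-γ g) (compose-cong refl (sym g-c)))))

      mediating : T ⇒ C₁
      mediating = mediate c (arrow ∘ s) (arrow ∘ t) s-eq t-eq sq

      pair : T ⇒ γ₀ P
      pair = element mediating
        (trans (dom-mediate c _ _ s-eq t-eq sq) dom-arrow∘)
        (trans (cod-mediate₁ c _ _ s-eq t-eq sq) (trans (sym (assoc _ _ _)) (sym (assoc _ _ _))))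

      γp₁∘pair : Functor.F₁ γ p₁ ∘ pair ≈ s
      γp₁∘pair = arrow-monic (trans (arrow-γ p₁)
        (trans (compose-cong arrow-element (assoc _ _ _))
          (mediate-proj₁ c _ _ s-eq t-eq sq {eq = cod-mediate₁ c _ _ s-eq t-eq sq})))

      γp₂∘pair : Functor.F₁ γ p₂ ∘ pair ≈ t
      γp₂∘pair = arrow-monic (trans (arrow-γ p₂)
        (trans (compose-cong arrow-element (assoc _ _ _))
          (mediate-proj₂ c _ _ s-eq t-eq sq {eq = cod-mediate₂ c _ _ s-eq t-eq sq})))

      pair-unique : (m : T ⇒ γ₀ P) → Functor.F₁ γ p₁ ∘ m ≈ s → Functor.F₁ γ p₂ ∘ m ≈ t → m ≈ pair
      pair-unique m a b = arrow-monic (trans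
        (mediate-unique c _ _ s-eq t-eq sq (arrow ∘ m)
          (trans (γ-meet p₁) (∘-respʳ (assoc _ _ _)))
          (trans (γ-meet p₂) (∘-respʳ (assoc _ _ _)))
          (trans (compose-cong refl (sym (assoc _ _ _))) (trans (sym (arrow-γ p₁)) (∘-respʳ a)))
          (trans (compose-cong refl (sym (assoc _ _ _))) (trans (sym (arrow-γ p₂)) (∘-respʳ b))))
        (sym arrow-element))

    γ-terminal : IsTerminal 𝓑 (Functor.F₀ γ (FiniteLimits.⊤ Γ-limits))
    γ-terminal = record
      { ! = element (bang ∘ (one ∘ !)) (cancelˡ dom-bang) (trans (pullˡ cod-bang) at!)
      ; !-unique = λ s → arrow-monic (trans
          (bang-unique₂ cod-arrow∘ (trans (pullˡ cod-bang) at!)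
            (trans dom-arrow∘ (sym (cancelˡ dom-bang))))
          (sym arrow-element))
      }

    γ-pullback : (f : GlobalArrow X Z) (g : GlobalArrow Y Z) →
                 IsPullback 𝓑 (Functor.F₁ γ f) (Functor.F₁ γ g)
                   (Functor.F₁ γ (Pullback.p₁ (FiniteLimits.pullback Γ-limits f g)))
                   (Functor.F₁ γ (Pullback.p₂ (FiniteLimits.pullback Γ-limits f g)))
    γ-pullback f g = record
      { commute = trans (sym (γ.homomorphism f p₁))
          (trans (γ.F-resp-≈ {f = f Γ.∘ p₁} {g = g Γ.∘ p₂}
                   (IsPullback.commute (Γ-isPullback f g)))
                 (γ.homomorphism g p₂))
      ; pair = pair
      ; p₁∘pair = γp₁∘pair
      ; p₂∘pair = γp₂∘pair
      ; pair-unique = pair-unique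
      }
      where
        open Pullback (FiniteLimits.pullback Γ-limits f g) using (p₁; p₂)
        open γPullback f g
        module Γ = Category (Γ L ℂ)
        module γ = Functor γ

  γ-preserves : PreservesFiniteLimits γ
  γ-preserves = preserves-chosen γ Γ-limits γ-terminal γ-pullback

-- Strict preservation of the chosen terminal object and pullback squares.
-- Objects of Γ ℂ are compared as global elements of C₀, arrows as global
-- elements of C₁.
record StrictlyPreserves {𝓐 : Category o ℓ e} {𝓑 : Category o′ ℓ′ e′}
         (M : FiniteLimits 𝓐) {L : FiniteLimits 𝓑} {ℂ : InternalCategory 𝓑}
         (K : ChosenFiniteLimits L ℂ) (F : Functor 𝓐 (Γ L ℂ)) : Set (o ⊔ ℓ ⊔ e′) where
  private
    module A = Category 𝓐
    module M = FiniteLimits M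
    module N = FiniteLimits (Sections.Γ-limits L K)
  open Category 𝓑
  open Functor F
  open Global L ℂ
  field
    terminal-F : F₀ M.⊤ ≈ N.⊤
    apex-F     : ∀ {A B X} (f : A A.⇒ X) (g : B A.⇒ X) →
                 F₀ (Pullback.P (M.pullback f g)) ≈ Pullback.P (N.pullback (F₁ f) (F₁ g))
    p₁-F       : ∀ {A B X} (f : A A.⇒ X) (g : B A.⇒ X) →
                 arr (F₁ (Pullback.p₁ (M.pullback f g))) ≈ arr (Pullback.p₁ (N.pullback (F₁ f) (F₁ g)))
    p₂-F       : ∀ {A B X} (f : A A.⇒ X) (g : B A.⇒ X) →
                 arr (F₁ (Pullback.p₂ (M.pullback f g))) ≈ arr (Pullback.p₂ (N.pullback (F₁ f) (F₁ g)))

module _ {𝓐 : Category o ℓ e} {𝓑 : Category o′ ℓ′ e′}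
         {M : FiniteLimits 𝓐} {L : FiniteLimits 𝓑} {ℂ : InternalCategory 𝓑}
         {K : ChosenFiniteLimits L ℂ} {F : Functor 𝓐 (Γ L ℂ)} where
  open Category 𝓑
  open Functor F
  open Global L ℂ hiding (Γ)
  open InternalCategory ℂ
  private
    module A = Category 𝓐
    module M = FiniteLimits M
    module N = FiniteLimits (Sections.Γ-limits L K)

  module _ (S : StrictlyPreserves M K F) where
    open StrictlyPreserves S

    private
      recod : ∀ {X Y Y′} → Y′ ≈ Y → GlobalArrow X Y → GlobalArrow X Y′
      recod p f = record { arr = arr f ; dom-arr = dom-arr f ; cod-arr = trans (cod-arr f) (sym p) }

    strict-terminal : IsTerminal (Γ L ℂ) (F₀ M.⊤)
    strict-terminal = record
      { ! = λ {X} → recod terminal-F (N.! {X})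
      ; !-unique = λ {X} f → N.!-unique {X} (recod (sym terminal-F) f)
      }

    strict-pullback : ∀ {A B X} (f : A A.⇒ X) (g : B A.⇒ X) →
                      IsPullback (Γ L ℂ) (F₁ f) (F₁ g) (F₁ (Pullback.p₁ (M.pullback f g)))
                                                       (F₁ (Pullback.p₂ (M.pullback f g)))
    strict-pullback f g = record
      { commute = resp-square Q.commute
      ; pair = λ h k eq → recod (apex-F f g) (R.pair h k eq)
      ; p₁∘pair = λ h k eq → trans (compose-cong refl (p₁-F f g)) (R.p₁∘pair h k eq)
      ; p₂∘pair = λ h k eq → trans (compose-cong refl (p₂-F f g)) (R.p₂∘pair h k eq)
      ; pair-unique = λ h k eq m a b → R.pair-unique h k eq (recod (sym (apex-F f g)) m)
          (trans (compose-cong refl (sym (p₁-F f g))) a)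
          (trans (compose-cong refl (sym (p₂-F f g))) b)
      }
      where
        module Q = Pullback (M.pullback f g)
        module R = Pullback (N.pullback (F₁ f) (F₁ g))

    strict⇒preserves : PreservesFiniteLimits F
    strict⇒preserves = preserves-chosen F M strict-terminal strict-pullback

------------------------------------------------------------------------
-- The comparison functor G# : Γ ℂ → Γ (G ℂ) and the canonical isomorphism
-- (G ℂ)(G# X , G# Y) ≅ G (ℂ(X , Y))

module Comparison {𝓑 : Category o ℓ e} {𝓑′ : Category o′ ℓ′ e′}
                  (L : FiniteLimits 𝓑) (L′ : FiniteLimits 𝓑′)
                  (G : Functor 𝓑 𝓑′) (lex : PreservesFiniteLimits G)
                  (ℂ : InternalCategory 𝓑) where
  private
    module B = Category 𝓑
    module L = FiniteLimits L
    module C = InternalCategory ℂ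
    module ΓC = Global L ℂ
    module P = PreservesFiniteLimits lex
    module G⊤ = IsTerminal (P.terminal L.isTerminal)
  open Category 𝓑′
  open FiniteLimits L′
  open Functor G renaming (F₀ to G₀; F₁ to G₁; F-resp-≈ to G-resp; identity to G-id)
  open Image L L′ G lex

  Gℂ : InternalCategory 𝓑′
  Gℂ = image ℂ

  private
    module ΓGC = Global L′ Gℂ

  unit : ⊤ ⇒ G₀ L.⊤
  unit = G⊤.!

  G# : Functor (Γ L ℂ) (Γ L′ Gℂ)
  G# = record
    { F₀ = λ X → G₁ X ∘ unit
    ; F₁ = λ f → record
        { arr = G₁ (ΓC.arr f) ∘ unit
        ; dom-arr = pullˡ (resp-triangle (ΓC.dom-arr f))
        ; cod-arr = pullˡ (resp-triangle (ΓC.cod-arr f))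
        }
    ; F-resp-≈ = λ p → ∘-respˡ (G-resp p)
    ; identity = trans (∘-respˡ (homomorphism _ _)) (assoc _ _ _)
    ; homomorphism = λ g f → compose-image ℂ refl refl
    }

  private
    module G# = Functor G#

  module _ (X Y : ΓC.GlobalObject) where
    private
      module GHom = Pullback (imagePullback (ΓC.hom X Y))
      module GC₀×C₀ = Pullback (imagePullback (L.product C.C₀ C.C₀))

      G! : ∀ {A T} {Z : ΓC.GlobalObject} {t : T ⇒ G₀ A} →
           G₁ (Z B.∘ L.!) ∘ t ≈ G#.F₀ Z ∘ !
      G! = trans (∘-respˡ (homomorphism _ _)) (trans (assoc _ _ _)
        (trans (∘-respʳ G⊤.!-unique₂) (sym (assoc _ _ _))))

      G-arrow-dom : G₁ C.dom ∘ G₁ (ΓC.arrow {X} {Y}) ≈ G#.F₀ X ∘ !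
      G-arrow-dom = trans (resp-triangle ΓC.dom-arrow) (trans (sym (identityʳ _)) G!)

      G-arrow-cod : G₁ C.cod ∘ G₁ (ΓC.arrow {X} {Y}) ≈ G#.F₀ Y ∘ !
      G-arrow-cod = trans (resp-triangle ΓC.cod-arrow) (trans (sym (identityʳ _)) G!)

      into : ΓGC.Hom (G#.F₀ X) (G#.F₀ Y) ⇒ G₀ (ΓC.Hom X Y)
      into = GHom.pair ΓGC.arrow (unit ∘ !) (GC₀×C₀.jointly-monic
        (trans (pullˡ (resp-triangle (L.π₁∘⟨⟩ _ _))) (trans ΓGC.dom-arrow
          (trans (assoc _ _ _) (sym (pullˡ (resp-triangle (L.π₁∘⟨⟩ _ _)))))))
        (trans (pullˡ (resp-triangle (L.π₂∘⟨⟩ _ _))) (trans ΓGC.cod-arrow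
          (trans (assoc _ _ _) (sym (pullˡ (resp-triangle (L.π₂∘⟨⟩ _ _))))))))

      out : G₀ (ΓC.Hom X Y) ⇒ ΓGC.Hom (G#.F₀ X) (G#.F₀ Y)
      out = ΓGC.element (G₁ ΓC.arrow) G-arrow-dom G-arrow-cod

    G-arrow-into : G₁ ΓC.arrow ∘ into ≈ ΓGC.arrow
    G-arrow-into = GHom.p₁∘pair _ _ _

    G-arrow-monic : ∀ {T} {s t : T ⇒ G₀ (ΓC.Hom X Y)} →
                    G₁ ΓC.arrow ∘ s ≈ G₁ ΓC.arrow ∘ t → s ≈ t
    G-arrow-monic p = GHom.jointly-monic p G⊤.!-unique₂

    Hom-iso : ΓGC.Hom (G#.F₀ X) (G#.F₀ Y) ≅ G₀ (ΓC.Hom X Y)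
    Hom-iso = record
      { to = into
      ; from = out
      ; to∘from = G-arrow-monic (trans (pullˡ G-arrow-into)
          (trans ΓGC.arrow-element (sym (identityʳ _))))
      ; from∘to = ΓGC.arrow-monic (trans (pullˡ ΓGC.arrow-element)
          (trans G-arrow-into (sym (identityʳ _))))
      }

------------------------------------------------------------------------
-- Geminal categories

record ModalData (o ℓ e : Level) : Set (lsuc (o ⊔ ℓ ⊔ e)) where
  field
    𝓑        : Category o ℓ e
    𝓑-limits : FiniteLimits 𝓑
    ℂ        : InternalCategory 𝓑
    ℂ-limits : ChosenFiniteLimits 𝓑-limits ℂ
    F        : Functor 𝓑 (Γ 𝓑-limits ℂ)
    F-strict : StrictlyPreserves 𝓑-limits ℂ-limits F

  open Sections 𝓑-limits ℂ-limits public using (γ; γ-preserves)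

  □ : Functor 𝓑 𝓑
  □ = γ ∘F F

  □-preserves : PreservesFiniteLimits □
  □-preserves = ∘F-preserves {G = γ} {F = F} γ-preserves
    (strict⇒preserves {M = 𝓑-limits} {K = ℂ-limits} {F = F} F-strict)

  open Image 𝓑-limits 𝓑-limits □ □-preserves public
    using () renaming (image to □-category; imageLimits to □-limits; imageFunctor to □-functor)

  □ℂ : InternalCategory 𝓑
  □ℂ = □-category ℂ

  □□ℂ : InternalCategory 𝓑
  □□ℂ = □-category □ℂ

  open Comparison 𝓑-limits 𝓑-limits □ □-preserves ℂ public
    using (unit; Hom-iso) renaming (G# to □#)

record PreGeminalCategory (o ℓ e : Level) : Set (lsuc (o ⊔ ℓ ⊔ e)) where
  field
    modalData : ModalData o ℓ e
  open ModalData modalData public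

  -- In ℍ∘F the functor F# : Γ ℂ → Γ (F ℂ) is written □#, under the
  -- identification of Γ (F ℂ) with Γ (□ ℂ).
  field
    ℍ   : InternalFunctor ℂ □ℂ
    ℍ∘F : EqualFunctors 𝓑-limits □ℂ (Γ-functor 𝓑-limits ℍ ∘F F) (□# ∘F F)

  open Category 𝓑
  open FiniteLimits 𝓑-limits using (⊤; _×_; ⟨_,_⟩; !)
  open Functor F using (F₀; F₁)
  open Functor □ public using () renaming (F₀ to □₀; F₁ to □₁)
  open ChosenFiniteLimits ℂ-limits public using () renaming (one to 1ℂ)
  open InternalFunctor ℍ using (H₀; H₁; compose-H; composable-H)
  private
    module C = InternalCategory ℂ
    module □C = InternalCategory □ℂ
    module ΓC = Global 𝓑-limits ℂ
    module Γ□C = Global 𝓑-limits □ℂ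
    module □# = Functor □#
    module □ = Functor □
    module F-strict = StrictlyPreserves F-strict
    module ℍ∘F = EqualFunctors ℍ∘F

  ℍ-one : H₀ ∘ 1ℂ ≈ □#.F₀ 1ℂ
  ℍ-one = trans (∘-respʳ (sym F-strict.terminal-F))
    (trans (ℍ∘F.≈₀ ⊤) (∘-respˡ (□.F-resp-≈ F-strict.terminal-F)))

  -- ℂ(1 , FA) → (□ℂ)(ℍ1 , ℍFA) ≅ □(ℂ(1 , FA))
  σ : ∀ A → □₀ A ⇒ □₀ (□₀ A)
  σ A = _≅_.to (Hom-iso 1ℂ (F₀ A))
      ∘ (Γ□C.castHom ℍ-one (ℍ∘F.≈₀ A)
      ∘ mapHom 𝓑-limits ℍ 1ℂ (F₀ A))

  π : ∀ A → □₀ A ⇒ C.C₁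
  π A = ΓC.arrow {1ℂ} {F₀ A}

  arrow-σ : ∀ A → □₁ (π A) ∘ σ A ≈ H₁ ∘ π A
  arrow-σ A = trans (pullˡ (Comparison.G-arrow-into 𝓑-limits 𝓑-limits □ □-preserves ℂ 1ℂ (F₀ A)))
    (trans (pullˡ Γ□C.arrow-element) Γ□C.arrow-element)

  private
    G-arrow-monic : ∀ {A T} {s t : T ⇒ □₀ (□₀ A)} → □₁ (π A) ∘ s ≈ □₁ (π A) ∘ t → s ≈ t
    G-arrow-monic {A} = Comparison.G-arrow-monic 𝓑-limits 𝓑-limits □ □-preserves ℂ 1ℂ (F₀ A)

    -- The generic composite underlying □₁ f.
    module _ {A B : Obj} (f : A ⇒ B) where
      Ff! : □₀ A ⇒ C.C₁
      Ff! = ΓC.arr (F₁ f) ∘ !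

      meets : C.cod ∘ π A ≈ C.dom ∘ Ff!
      meets = Sections.γ-meet′ 𝓑-limits ℂ-limits (F₁ f)

      composite : □₀ A ⇒ C.C₁
      composite = C.compose (π A) Ff! meets

      arrow-□ : π B ∘ □₁ f ≈ composite
      arrow-□ = Sections.arrow-γ′ 𝓑-limits ℂ-limits (F₁ f)

      □Ff! : □₁ Ff! ∘ σ A ≈ H₁ ∘ Ff!
      □Ff! = begin
        □₁ (ΓC.arr (F₁ f) ∘ !) ∘ σ A         ≈⟨ ∘-respˡ (□.homomorphism _ _) ⟩
        (□₁ (ΓC.arr (F₁ f)) ∘ □₁ !) ∘ σ A    ≈⟨ assoc _ _ _ ⟩
        □₁ (ΓC.arr (F₁ f)) ∘ (□₁ ! ∘ σ A)    ≈⟨ ∘-respʳ (IsTerminal.!-unique₂ □⊤) ⟩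
        □₁ (ΓC.arr (F₁ f)) ∘ (unit ∘ !)      ≈⟨ assoc _ _ _ ⟨
        (□₁ (ΓC.arr (F₁ f)) ∘ unit) ∘ !      ≈⟨ ∘-respˡ (ℍ∘F.≈₁ f) ⟨
        (H₁ ∘ ΓC.arr (F₁ f)) ∘ !             ≈⟨ assoc _ _ _ ⟩
        H₁ ∘ (ΓC.arr (F₁ f) ∘ !)             ∎
        where
          open SetoidReasoning (hom-setoid _ _)
          □⊤ : IsTerminal 𝓑 (□₀ ⊤)
          □⊤ = PreservesFiniteLimits.terminal □-preserves (FiniteLimits.isTerminal 𝓑-limits)

      □composite : □₁ composite ∘ σ A ≈ H₁ ∘ composite
      □composite = trans
        (Image.compose-image 𝓑-limits 𝓑-limits □ □-preserves ℂ
          {f = π A} {g = Ff!} {eq = meets} {t = σ A}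
          {f′ = H₁ ∘ π A} {g′ = H₁ ∘ Ff!} {eq′ = composable-H meets} (arrow-σ A) □Ff!)
        (sym (compose-H {f = π A} {g = Ff!} {eq = meets} {eq′ = composable-H meets}))

  σ-natural : ∀ {A B} (f : A ⇒ B) → σ B ∘ □₁ f ≈ □₁ (□₁ f) ∘ σ A
  σ-natural {A} {B} f = G-arrow-monic {B} (begin
    □₁ (π B) ∘ (σ B ∘ □₁ f)         ≈⟨ swapˡ (arrow-σ B) ⟩
    H₁ ∘ (π B ∘ □₁ f)             ≈⟨ ∘-respʳ (arrow-□ f) ⟩
    H₁ ∘ composite f                   ≈⟨ □composite f ⟨
    □₁ (composite f) ∘ σ A             ≈⟨ ∘-respˡ (□.F-resp-≈ (arrow-□ f)) ⟨
    □₁ (π B ∘ □₁ f) ∘ σ A         ≈⟨ ∘-respˡ (□.homomorphism (π B) (□₁ f)) ⟩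
    (□₁ (π B) ∘ □₁ (□₁ f)) ∘ σ A    ≈⟨ assoc (□₁ (π B)) (□₁ (□₁ f)) (σ A) ⟩
    □₁ (π B) ∘ (□₁ (□₁ f) ∘ σ A)    ∎)
    where open SetoidReasoning (hom-setoid _ _)

  ℍ# : InternalFunctor □ℂ □□ℂ
  ℍ# = record
    { H₀ = σ C.C₀
    ; H₁ = σ C.C₁
    ; dom-H = sym (σ-natural C.dom)
    ; cod-H = sym (σ-natural C.cod)
    ; ident-H = σ-natural C.ident
    ; comp-H = trans (σ-natural C.comp) (∘-respʳ (□□C.C₂.pair-unique _ _ _ _
        (sym (σ-natural C.C₂.p₁)) (sym (σ-natural C.C₂.p₂))))
    }
    where module □□C = InternalCategory □□ℂ

record GeminalCategory (o ℓ e : Level) : Set (lsuc (o ⊔ ℓ ⊔ e)) where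
  field
    preGeminal : PreGeminalCategory o ℓ e
  open PreGeminalCategory preGeminal public
  field
    ℍ-strict : StrictlyPreservesLimits ℂ-limits (□-limits ℂ ℂ-limits) ℍ
    □ℍ∘ℍ     : □-functor ℍ ∘I ℍ ≈I ℍ# ∘I ℍ

{-# OPTIONS --safe #-}
module Submission where

open import Level using (_⊔_)
open import Data.Product using (Σ-syntax; _,_)
open import Defs
import Relation.Binary.Reasoning.Setoid as SetoidReasoning

-- This is Löb's theorem, with ℍ as quotation. Diagonalisation in ℂ, where the
-- chosen pullbacks play the role of substitution, yields a global object W of
-- which F D, for D = ℂ(W, F A), is a retract. Hence D codes the arrows
-- F D → F A, and such an arrow d can be applied to its own quotation, giving
-- selfApply d : 1 → F A. Given k : F □A → F A, put d = k ∘ F selfApply and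
-- Y k = selfApply d. Since quotation commutes with self-application, by
-- □ℍ ∘ ℍ = ℍ# ∘ ℍ, unfolding selfApply d gives k applied to the quotation of Y k.

-- Precomposition on internal hom-objects

module Precomposition {o ℓ e} {𝓑 : Category o ℓ e} (L : FiniteLimits 𝓑) (ℂ : InternalCategory 𝓑) where
  open Category 𝓑
  open FiniteLimits L
  open InternalCategory ℂ
  open Global L ℂ hiding (Γ)

  private
    variable
      S T : Obj
      X Y Z : GlobalObject

  constant-meet : (h : GlobalArrow X Y) {s : T ⇒ Hom Y Z} →
                  cod ∘ (arr h ∘ !) ≈ dom ∘ (arrow ∘ s)
  constant-meet h = trans (pullˡ (cod-arr h)) (sym dom-arrow∘)

  opaque
    precompose : GlobalArrow X Y → T ⇒ Hom Y Z → T ⇒ Hom X Z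
    precompose h s = element (compose (arr h ∘ !) (arrow ∘ s) (constant-meet h))
      (trans dom-compose (pullˡ (dom-arr h))) (trans cod-compose cod-arrow∘)

    arrow-precompose : (h : GlobalArrow X Y) (s : T ⇒ Hom Y Z) →
      arrow ∘ precompose h s ≈ compose (arr h ∘ !) (arrow ∘ s) (constant-meet h)
    arrow-precompose h s = arrow-element

  arrow-precompose∘ : (h : GlobalArrow X Y) (s : T ⇒ Hom Y Z) (t : S ⇒ T) →
    arrow ∘ (precompose h s ∘ t) ≈ compose (arr h ∘ !) (arrow ∘ (s ∘ t)) (constant-meet h)
  arrow-precompose∘ h s t = begin
    arrow ∘ (precompose h s ∘ t)          ≈⟨ pullˡ (arrow-precompose h s) ⟩
    compose (arr h ∘ !) (arrow ∘ s) _ ∘ t ≈⟨ compose-∘ {eq′ = swapˡ′} ⟩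
    compose ((arr h ∘ !) ∘ t) ((arrow ∘ s) ∘ t) _
      ≈⟨ compose-cong (trans (assoc _ _ _) (∘-respʳ !-unique₂)) (assoc _ _ _) ⟩
    compose (arr h ∘ !) (arrow ∘ (s ∘ t)) _      ∎
    where
      open SetoidReasoning (hom-setoid _ _)
      swapˡ′ : cod ∘ ((arr h ∘ !) ∘ t) ≈ dom ∘ ((arrow ∘ s) ∘ t)
      swapˡ′ = swapˡ (constant-meet h)

  -- Precomposition is contravariant, so by associativity the composite sends `s` to `i` then `j`
  -- then `s`, and `ji` cancels the first two. A retraction onto `X` thus makes `Hom X Z` a retract
  -- of `Hom Y Z`.
  precompose-retract : (i : GlobalArrow X Y) (j : GlobalArrow Y X) →
    Category._≈_ (Γ L ℂ) (Category._∘_ (Γ L ℂ) j i) (Category.id (Γ L ℂ) {X}) →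
    precompose {Z = Z} i id ∘ precompose j id ≈ id
  precompose-retract {X} {Y} i j ji = arrow-monic (begin
    arrow ∘ (precompose i id ∘ precompose j id)
      ≈⟨ arrow-precompose∘ i id (precompose j id) ⟩
    compose (arr i ∘ !) (arrow ∘ (id ∘ precompose j id)) _
      ≈⟨ compose-cong {eq′ = trans meet-ij (sym dom-compose)} refl
           (trans (∘-respʳ (identityˡ _)) (arrow-precompose j id)) ⟩
    compose (arr i ∘ !) (compose (arr j ∘ !) (arrow ∘ id) (constant-meet j)) _
      ≈⟨ compose-assoc _ _ _ meet-ij (constant-meet j) (trans cod-compose (constant-meet j)) _ ⟨
    compose (compose (arr i ∘ !) (arr j ∘ !) meet-ij) (arrow ∘ id) _
      ≈⟨ compose-cong {eq′ = cancelˡ cod-ident} (trans (sym compose-∘) (trans (∘-respˡ ji)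
           (trans (assoc _ _ _) (∘-respʳ (sym dom-arrow∘))))) refl ⟩
    compose (ident ∘ (dom ∘ (arrow ∘ id))) (arrow ∘ id) _
      ≈⟨ compose-identˡ _ _ ⟩
    arrow ∘ id ∎)
    where
      open SetoidReasoning (hom-setoid _ _)
      meet-ij : ∀ {T} → cod ∘ (arr i ∘ ! {T}) ≈ dom ∘ (arr j ∘ !)
      meet-ij = swapˡ (trans (cod-arr i) (sym (dom-arr j)))

-- Monomorphisms under limit-preserving functors

module _ {o ℓ e o′ ℓ′ e′} {𝓐 : Category o ℓ e} {𝓑 : Category o′ ℓ′ e′} {G : Functor 𝓐 𝓑} where
  private
    module A = Category 𝓐
    module B = Category 𝓑
  open Functor G

  -- Being monic is a limit condition: the kernel pair is `(id , id)`. The image of this pullback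
  -- square is again a pullback, through which `s` and `t` both factor as `u`.
  preserves-monic : PreservesFiniteLimits G → ∀ {X Y} (m : X A.⇒ Y) →
    (∀ {T} {s t : T A.⇒ X} → m A.∘ s A.≈ m A.∘ t → s A.≈ t) →
    ∀ {T} {s t : T B.⇒ F₀ X} → F₁ m B.∘ s B.≈ F₁ m B.∘ t → s B.≈ t
  preserves-monic lex {X} m monic {s = s} {t} p = begin
    s                           ≈⟨ B.identityˡ s ⟨
    B.id B.∘ s                  ≈⟨ B.∘-respˡ identity ⟨
    F₁ A.id B.∘ s               ≈⟨ B.∘-respʳ (K.p₁∘pair s t p) ⟨
    F₁ A.id B.∘ (F₁ A.id B.∘ u) ≈⟨ B.∘-respʳ (K.p₂∘pair s t p) ⟩
    F₁ A.id B.∘ t               ≈⟨ B.∘-respˡ identity ⟩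
    B.id B.∘ t                  ≈⟨ B.identityˡ t ⟩
    t                           ∎
    where
      open SetoidReasoning (B.hom-setoid _ _)
      kernel : IsPullback 𝓐 m m (A.id {X}) (A.id {X})
      kernel = record
        { commute = A.refl
        ; pair = λ h k eq → h
        ; p₁∘pair = λ h k eq → A.identityˡ h
        ; p₂∘pair = λ h k eq → A.trans (A.identityˡ h) (monic eq)
        ; pair-unique = λ h k eq u a b → A.trans (A.sym (A.identityˡ u)) a
        }
      module K = IsPullback (PreservesFiniteLimits.pullback lex kernel)
      u = K.pair s t p

-- The structure of a geminal category, with □ A known only through its
-- generalised elements, the internal arrows 1 → F A. Having □ abstract here is
-- essential: the concrete one unfolds to hom-objects at every comparison.
record Modality {o ℓ e} {𝓑 : Category o ℓ e} (L : FiniteLimits 𝓑) {ℂ : InternalCategory 𝓑}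
                (K : ChosenFiniteLimits L ℂ) : Set (o ⊔ ℓ ⊔ e) where
  open Category 𝓑
  open FiniteLimits L using (⊤; !)
  open InternalCategory ℂ using (C₁; dom; cod; compose)
  open Global L ℂ using (arr)
  open ChosenFiniteLimits K using (one)
  field
    F           : Functor 𝓑 (Γ L ℂ)
    F-preserves : PreservesFiniteLimits F
    □           : Functor 𝓑 𝓑
    □-preserves : PreservesFiniteLimits □
  open Functor F public using (F₀; F₁)
  open Functor □ public using () renaming (F₀ to □₀; F₁ to □₁)
  open Comparison L L □ □-preserves ℂ public using (unit) renaming (Gℂ to □ℂ; G# to □#)
  field
    π         : ∀ A → □₀ A ⇒ C₁
    dom-π     : ∀ A → dom ∘ π A ≈ one ∘ !
    cod-π     : ∀ A → cod ∘ π A ≈ F₀ A ∘ !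
    π-monic   : ∀ A {T} {s t : T ⇒ □₀ A} → π A ∘ s ≈ π A ∘ t → s ≈ t
    reflect   : ∀ A {T} (f : T ⇒ C₁) → dom ∘ f ≈ one ∘ ! → cod ∘ f ≈ F₀ A ∘ ! → T ⇒ □₀ A
    π-reflect : ∀ A {T} (f : T ⇒ C₁) (d : dom ∘ f ≈ one ∘ !) (c : cod ∘ f ≈ F₀ A ∘ !) →
                π A ∘ reflect A f d c ≈ f
    π-□       : ∀ {A B} (f : A ⇒ B) (eq : cod ∘ π A ≈ dom ∘ (arr (F₁ f) ∘ !)) →
                π B ∘ □₁ f ≈ compose (π A) (arr (F₁ f) ∘ !) eq
    ℍ         : InternalFunctor ℂ □ℂ
  open InternalFunctor ℍ public using (H₀; H₁)
  field
    ℍ-F₀      : ∀ A → H₀ ∘ F₀ A ≈ Functor.F₀ □# (F₀ A)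
    ℍ-F₁      : ∀ {A B} (f : A ⇒ B) → H₁ ∘ arr (F₁ f) ≈ □₁ (arr (F₁ f)) ∘ unit
    σ         : ∀ A → □₀ A ⇒ □₀ (□₀ A)
    π-σ       : ∀ A → □₁ (π A) ∘ σ A ≈ H₁ ∘ π A
    σ-natural : ∀ {A B} (f : A ⇒ B) → σ B ∘ □₁ f ≈ □₁ (□₁ f) ∘ σ A
    -- With C₁ abbreviated, checking this equation against □ℍ ∘ ℍ = ℍ# ∘ ℍ becomes intractable.
    □H₁∘H₁    : □₁ H₁ ∘ H₁ ≈ σ (InternalCategory.C₁ ℂ) ∘ H₁

-- Quotation, self-application and the fixed point

module Loeb {o ℓ e} {𝓑 : Category o ℓ e} {L : FiniteLimits 𝓑} {ℂ : InternalCategory 𝓑}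
            {K : ChosenFiniteLimits L ℂ} (M : Modality L K) where
  open Category 𝓑
  open FiniteLimits L using (!; !-unique₂)
  open InternalCategory ℂ
  open Global L ℂ hiding (Γ)
  open ChosenFiniteLimits K using (one)
  open Modality M
  open InternalFunctor ℍ using (compose-H; composable-H)
  open Precomposition L ℂ
  private
    module □ = Functor □
    module Γ□C = Global L □ℂ

    variable
      T : Obj

  dom-π∘ : ∀ A {t : T ⇒ □₀ A} → dom ∘ (π A ∘ t) ≈ one ∘ !
  dom-π∘ A = trans (swapˡ (dom-π A)) (∘-respʳ !-unique₂)

  cod-π∘ : ∀ A {t : T ⇒ □₀ A} → cod ∘ (π A ∘ t) ≈ F₀ A ∘ !
  cod-π∘ A = trans (swapˡ (cod-π A)) (∘-respʳ !-unique₂)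

  π-meet : ∀ {A B} (f : A ⇒ B) {t : T ⇒ □₀ A} → cod ∘ (π A ∘ t) ≈ dom ∘ (arr (F₁ f) ∘ !)
  π-meet {A = A} f = trans (cod-π∘ A) (sym (pullˡ (dom-arr (F₁ f))))

  π-□∘ : ∀ {A B} (f : A ⇒ B) (t : T ⇒ □₀ A) →
         π B ∘ (□₁ f ∘ t) ≈ compose (π A ∘ t) (arr (F₁ f) ∘ !) (π-meet f)
  π-□∘ {A = A} {B} f t = begin
    π B ∘ (□₁ f ∘ t)                      ≈⟨ pullˡ (π-□ f eq) ⟩
    compose (π A) (arr (F₁ f) ∘ !) eq ∘ t ≈⟨ compose-∘ {eq′ = swapˡ eq} ⟩
    compose (π A ∘ t) ((arr (F₁ f) ∘ !) ∘ t) _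
      ≈⟨ compose-cong refl (trans (assoc _ _ _) (∘-respʳ !-unique₂)) ⟩
    compose (π A ∘ t) (arr (F₁ f) ∘ !) _  ∎
    where
      open SetoidReasoning (hom-setoid _ _)
      eq : cod ∘ π A ≈ dom ∘ (arr (F₁ f) ∘ !)
      eq = trans (cod-π A) (sym (pullˡ (dom-arr (F₁ f))))

  module _ (A B : Obj) where
    opaque
      -- The analogue of `σ` for arrows out of `F A` instead of out of the terminal object.
      quotation : Hom (F₀ A) (F₀ B) ⇒ □₀ (Hom (F₀ A) (F₀ B))
      quotation = _≅_.to (Comparison.Hom-iso L L □ □-preserves ℂ (F₀ A) (F₀ B))
          ∘ (Γ□C.castHom (ℍ-F₀ A) (ℍ-F₀ B)
          ∘ mapHom L ℍ (F₀ A) (F₀ B))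

      arrow-quotation : □₁ (arrow {F₀ A} {F₀ B}) ∘ quotation ≈ H₁ ∘ arrow
      arrow-quotation = trans
        (pullˡ (Comparison.G-arrow-into L L □ □-preserves ℂ (F₀ A) (F₀ B)))
        (trans (pullˡ Γ□C.arrow-element) Γ□C.arrow-element)

    -- After the monomorphism `□₁ (□₁ b)` both sides become images of `H₁ ∘ b`, one under `σ` and
    -- the other under `□₁ H₁`. The geminal axiom `□H₁∘H₁` equates them.
    σ-quotation : σ (Hom (F₀ A) (F₀ B)) ∘ quotation ≈ □₁ quotation ∘ quotation
    σ-quotation = □□arrow-monic (begin
      □₁ (□₁ b) ∘ (σ _ ∘ quotation)          ≈⟨ swapˡ (σ-natural b) ⟨
      σ _ ∘ (□₁ b ∘ quotation)               ≈⟨ ∘-respʳ arrow-quotation ⟩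
      σ _ ∘ (H₁ ∘ b)                         ≈⟨ swapˡ □H₁∘H₁ ⟨
      □₁ H₁ ∘ (H₁ ∘ b)                       ≈⟨ ∘-respʳ arrow-quotation ⟨
      □₁ H₁ ∘ (□₁ b ∘ quotation)             ≈⟨ swapˡ (□.resp-square arrow-quotation) ⟨
      □₁ (□₁ b) ∘ (□₁ quotation ∘ quotation) ∎)
      where
        open SetoidReasoning (hom-setoid _ _)
        b : Hom (F₀ A) (F₀ B) ⇒ C₁
        b = arrow
        □□arrow-monic : {s t : T ⇒ □₀ (□₀ (Hom (F₀ A) (F₀ B)))} →
                        □₁ (□₁ b) ∘ s ≈ □₁ (□₁ b) ∘ t → s ≈ t
        □□arrow-monic = preserves-monic {G = □} □-preserves (□₁ b)
          (preserves-monic {G = □} □-preserves b arrow-monic)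

  module _ (A D : Obj) (ρ : Hom (F₀ D) (F₀ A) ⇒ D) where
    private
      q : Hom (F₀ D) (F₀ A) ⇒ □₀ (Hom (F₀ D) (F₀ A))
      q = quotation D A

      -- At an arrow d : F D → F A, `a` is the quotation of d, recoded by `ρ` as an element 1 → F D,
      -- and `b` is d itself.
      a b : Hom (F₀ D) (F₀ A) ⇒ C₁
      a = π D ∘ (□₁ ρ ∘ q)
      b = arrow {F₀ D} {F₀ A}

      ab : cod ∘ a ≈ dom ∘ b
      ab = trans (cod-π∘ D) (sym dom-arrow)

    opaque
      selfApply : Hom (F₀ D) (F₀ A) ⇒ □₀ A
      selfApply = reflect A (compose a b ab)
        (trans dom-compose (dom-π∘ D)) (trans cod-compose cod-arrow)

      π-selfApply : π A ∘ selfApply ≈ compose a b ab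
      π-selfApply = π-reflect A _ _ _

    private
      -- The code of d is built from its quotation, so quoting the code means quoting a quotation.
      -- `σ-quotation` handles this, and naturality of `σ` at `ρ` handles the recoding.
      □a : □₁ a ∘ q ≈ H₁ ∘ a
      □a = begin
        □₁ (π D ∘ (□₁ ρ ∘ q)) ∘ q           ≈⟨ ∘-respˡ (□.homomorphism (π D) (□₁ ρ ∘ q)) ⟩
        (□₁ (π D) ∘ □₁ (□₁ ρ ∘ q)) ∘ q      ≈⟨ assoc _ _ _ ⟩
        □₁ (π D) ∘ (□₁ (□₁ ρ ∘ q) ∘ q)      ≈⟨ ∘-respʳ (∘-respˡ (□.homomorphism (□₁ ρ) q)) ⟩
        □₁ (π D) ∘ ((□₁ (□₁ ρ) ∘ □₁ q) ∘ q) ≈⟨ ∘-respʳ (assoc _ _ _) ⟩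
        □₁ (π D) ∘ (□₁ (□₁ ρ) ∘ (□₁ q ∘ q)) ≈⟨ ∘-respʳ (∘-respʳ (σ-quotation D A)) ⟨
        □₁ (π D) ∘ (□₁ (□₁ ρ) ∘ (σ _ ∘ q))  ≈⟨ ∘-respʳ (swapˡ (σ-natural ρ)) ⟨
        □₁ (π D) ∘ (σ D ∘ (□₁ ρ ∘ q))       ≈⟨ swapˡ (π-σ D) ⟩
        H₁ ∘ (π D ∘ (□₁ ρ ∘ q))             ∎
        where open SetoidReasoning (hom-setoid _ _)

    -- Quotation commutes with both factors `a` and `b`, and `ℍ` preserves their composite; the
    -- equation is tested after the monomorphism `□₁ (π A)`.
    σ-selfApply : σ A ∘ selfApply ≈ □₁ selfApply ∘ q
    σ-selfApply = preserves-monic {G = □} □-preserves (π A) (π-monic A) (begin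
      □₁ (π A) ∘ (σ A ∘ selfApply) ≈⟨ swapˡ (π-σ A) ⟩
      H₁ ∘ (π A ∘ selfApply)       ≈⟨ ∘-respʳ π-selfApply ⟩
      H₁ ∘ compose a b ab          ≈⟨ compose-H ⟩
      InternalCategory.compose □ℂ (H₁ ∘ a) (H₁ ∘ b) (composable-H ab)
        ≈⟨ Image.compose-image L L □ □-preserves ℂ □a (arrow-quotation D A) ⟨
      □₁ (compose a b ab) ∘ q       ≈⟨ ∘-respˡ (□.F-resp-≈ π-selfApply) ⟨
      □₁ (π A ∘ selfApply) ∘ q      ≈⟨ ∘-respˡ (□.homomorphism (π A) selfApply) ⟩
      (□₁ (π A) ∘ □₁ selfApply) ∘ q ≈⟨ assoc _ _ _ ⟩
      □₁ (π A) ∘ (□₁ selfApply ∘ q) ∎)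
      where open SetoidReasoning (hom-setoid _ _)

    module _ (τ : D ⇒ Hom (F₀ D) (F₀ A)) (τρ : τ ∘ ρ ≈ id) where
      private
        -- Self-application read on codes: decode by `τ`, then apply. Hence `p` sends k : F □A → F A
        -- to the arrow d = k ∘ F f.
        f : D ⇒ □₀ A
        f = selfApply ∘ τ

        p : Hom (F₀ (□₀ A)) (F₀ A) ⇒ Hom (F₀ D) (F₀ A)
        p = precompose (F₁ f) id

      fixedPoint : Hom (F₀ (□₀ A)) (F₀ A) ⇒ □₀ A
      fixedPoint = selfApply ∘ p

      private
        -- Feeding the code of d to F f yields the quotation of the fixed point: decoding cancels
        -- recoding by `τρ`, and `σ-selfApply` does the rest.
        □f : □₁ f ∘ ((□₁ ρ ∘ q) ∘ p) ≈ σ A ∘ fixedPoint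
        □f = begin
          □₁ f ∘ ((□₁ ρ ∘ q) ∘ p) ≈⟨ ∘-respʳ (assoc _ _ _) ⟩
          □₁ f ∘ (□₁ ρ ∘ (q ∘ p)) ≈⟨ pullˡ (□.resp-triangle fρ) ⟩
          □₁ selfApply ∘ (q ∘ p)  ≈⟨ swapˡ σ-selfApply ⟨
          σ A ∘ (selfApply ∘ p)   ∎
          where
            open SetoidReasoning (hom-setoid _ _)
            fρ : f ∘ ρ ≈ selfApply
            fρ = trans (assoc _ _ _) (trans (∘-respʳ τρ) (identityʳ _))

        k : Hom (F₀ (□₀ A)) (F₀ A) ⇒ C₁
        k = arrow

        fk : cod ∘ (arr (F₁ f) ∘ !) ≈ dom ∘ (k ∘ id)
        fk = constant-meet (F₁ f)

      -- Self-application of d is the code of d, then F f, then k. Reassociating, `π-□∘` turns the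
      -- first two into `□₁ f` at the code of d, and `□f` evaluates that.
      fixedPoint-equation :
        (eq : cod ∘ (π (□₀ A) ∘ (σ A ∘ fixedPoint)) ≈ dom ∘ (k ∘ id)) →
        π A ∘ fixedPoint ≈ compose (π (□₀ A) ∘ (σ A ∘ fixedPoint)) (k ∘ id) eq
      fixedPoint-equation eq = begin
        π A ∘ (selfApply ∘ p) ≈⟨ pullˡ π-selfApply ⟩
        compose a b ab ∘ p    ≈⟨ compose-∘ {eq′ = swapˡ ab} ⟩
        compose (a ∘ p) (b ∘ p) _
          ≈⟨ compose-cong {eq′ = trans (π-meet f) (sym dom-compose)} (assoc _ _ _) (arrow-precompose (F₁ f) id) ⟩
        compose (π D ∘ ((□₁ ρ ∘ q) ∘ p)) (compose (arr (F₁ f) ∘ !) (k ∘ id) fk) _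
          ≈⟨ compose-assoc _ _ _ (π-meet f) fk (trans cod-compose fk) _ ⟨
        compose (compose (π D ∘ ((□₁ ρ ∘ q) ∘ p)) (arr (F₁ f) ∘ !) (π-meet f)) (k ∘ id) _
          ≈⟨ compose-cong (trans (sym (π-□∘ f ((□₁ ρ ∘ q) ∘ p))) (∘-respʳ □f)) refl ⟩
        compose (π (□₀ A) ∘ (σ A ∘ fixedPoint)) (k ∘ id) eq ∎
        where open SetoidReasoning (hom-setoid _ _)

-- Retractions between pullbacks

module _ {o ℓ e} (𝓒 : Category o ℓ e) where
  open Category 𝓒

  record Retraction (X Y : Obj) : Set (ℓ ⊔ e) where
    no-eta-equality
    field
      section   : X ⇒ Y
      retract   : Y ⇒ X
      isRetract : retract ∘ section ≈ id

  -- Each pullback maps to the other by keeping the component in `A`; `ι` and `t` supply the other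
  -- component. As `B` is terminal, the component in `A` alone determines a map into `P`.
  pullback-retraction : ∀ {A B C X P W} {f : A ⇒ X} {g : B ⇒ X} {q : C ⇒ X}
    {p₁ : P ⇒ A} {p₂ : P ⇒ B} {w₁ : W ⇒ A} {w₂ : W ⇒ C} →
    IsPullback 𝓒 f g p₁ p₂ → IsPullback 𝓒 f q w₁ w₂ → IsTerminal 𝓒 B →
    (ι : C ⇒ B) → q ≈ g ∘ ι → (P ⇒ C) → Retraction P W
  pullback-retraction {f = f} {g} {q} {p₁} {p₂} {w₁} {w₂} isP isW isB ι qι t = record
    { section = i
    ; retract = j
    ; isRetract = P.jointly-monic
        (trans (pullˡ (P.p₁∘pair _ _ j-eq)) (trans (W.p₁∘pair _ _ i-eq) (sym (identityʳ _))))
        (IsTerminal.!-unique₂ isB)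
    }
    where
      module P = IsPullback isP
      module W = IsPullback isW

      i-eq : f ∘ p₁ ≈ q ∘ t
      i-eq = trans P.commute (trans (∘-respʳ (IsTerminal.!-unique₂ isB)) (sym (trans (∘-respˡ qι) (assoc _ _ _))))

      j-eq : f ∘ w₁ ≈ g ∘ (ι ∘ w₂)
      j-eq = trans W.commute (trans (∘-respˡ qι) (assoc _ _ _))

      i = W.pair p₁ t i-eq
      j = P.pair w₁ (ι ∘ w₂) j-eq

-- Diagonalisation and the object of codes

module Diagonal {o ℓ e} {𝓑 : Category o ℓ e} {L : FiniteLimits 𝓑} {ℂ : InternalCategory 𝓑}
                {K : ChosenFiniteLimits L ℂ} (M : Modality L K) (A : Category.Obj 𝓑) where
  open Category 𝓑
  open FiniteLimits L using (⊤; !; !-unique₂; pullback; isTerminal)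
  open InternalCategory ℂ
  open Global L ℂ hiding (Γ)
  open ChosenFiniteLimits K using (one; apex; module Cospan)
  open Modality M
  open Loeb M
  open Precomposition L ℂ
  private
    module ΓC = Category (Γ L ℂ)

  module Over = Pullback (pullback cod (F₀ C₁))
  module Into = Pullback (pullback cod (F₀ A))

  -- `H₁ ∘ x` is an element of `□ C₁`, that is, an arrow 1 → F C₁ coding `x`. It therefore forms a
  -- cospan with any `x` whose codomain is F C₁.
  quote-meet : ∀ {T} {x : T ⇒ C₁} {t : T ⇒ ⊤} → cod ∘ x ≈ F₀ C₁ ∘ t →
               cod ∘ x ≈ cod ∘ (π C₁ ∘ (H₁ ∘ x))
  quote-meet p = trans p (trans (∘-respʳ !-unique₂) (sym (cod-π∘ C₁)))

  -- Diagonalisation: an arrow x : X → F C₁ of ℂ goes to its fibre over its own code.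
  diag : Over.P ⇒ C₀
  diag = apex ∘ Cospan.pair Over.p₁ (π C₁ ∘ (H₁ ∘ Over.p₁)) (quote-meet Over.commute)

  -- Indexed by x, the arrows diag x → F A.
  module Family = Pullback (pullback diag (dom ∘ Into.p₁))

  index : Family.P ⇒ C₁
  index = Over.p₁ ∘ Family.p₁

  ⌜index⌝ : ⊤ ⇒ C₁
  ⌜index⌝ = arr (F₁ index)

  quoted : GlobalArrow one (F₀ C₁)
  quoted = record
    { arr = π C₁ ∘ (H₁ ∘ ⌜index⌝)
    ; dom-arr = trans (dom-π∘ C₁) (trans (∘-respʳ !-unique₂) (identityʳ one))
    ; cod-arr = trans (cod-π∘ C₁) (trans (∘-respʳ !-unique₂) (identityʳ (F₀ C₁)))
    }

  -- W is diag applied to F index itself.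
  module W = Pullback (Sections.Γ-pullback L K (F₁ index) quoted)

  point : ⊤ ⇒ Over.P
  point = Over.pair ⌜index⌝ id (trans (cod-arr (F₁ index)) (sym (identityʳ _)))

  diag-point : diag ∘ point ≈ W.P
  diag-point = trans (assoc _ _ _) (∘-respʳ (Cospan.pair-unique _ _ _ _
    (trans (pullˡ (Cospan.p₁∘pair _ _ _)) p₁-point)
    (trans (pullˡ (Cospan.p₂∘pair _ _ _))
      (trans (assoc _ _ _) (∘-respʳ (trans (assoc _ _ _) (∘-respʳ p₁-point)))))))
    where
      p₁-point : Over.p₁ ∘ point ≈ ⌜index⌝
      p₁-point = Over.p₁∘pair _ _ _

  D : Obj
  D = Hom W.P (F₀ A)

  arrow-over : diag ∘ (point ∘ !) ≈ (dom ∘ Into.p₁) ∘ Into.pair arrow ! cod-arrow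
  arrow-over = begin
    diag ∘ (point ∘ !)                            ≈⟨ pullˡ diag-point ⟩
    W.P ∘ !                                       ≈⟨ dom-arrow ⟨
    dom ∘ arrow                                   ≈⟨ ∘-respʳ (Into.p₁∘pair arrow ! cod-arrow) ⟨
    dom ∘ (Into.p₁ ∘ Into.pair arrow ! cod-arrow) ≈⟨ assoc _ _ _ ⟨
    (dom ∘ Into.p₁) ∘ Into.pair arrow ! cod-arrow ∎
    where open SetoidReasoning (hom-setoid _ _)

  include : D ⇒ Family.P
  include = Family.pair (point ∘ !) (Into.pair arrow ! cod-arrow) arrow-over

  p₁-include : ∀ {T} {u : T ⇒ D} → Into.p₁ ∘ (Family.p₂ ∘ (include ∘ u)) ≈ arrow ∘ u
  p₁-include = trans (∘-respʳ (pullˡ (Family.p₂∘pair _ _ arrow-over))) (pullˡ (Into.p₁∘pair arrow ! cod-arrow))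

  over-point : ∀ {T} (h : T ⇒ Family.P) (k : T ⇒ ⊤) → index ∘ h ≈ ⌜index⌝ ∘ k → Family.p₁ ∘ h ≈ point ∘ !
  over-point h k eq = Over.jointly-monic
    (trans (sym (assoc _ _ _)) (trans eq
      (trans (∘-respʳ !-unique₂) (sym (pullˡ (Over.p₁∘pair _ _ _))))))
    !-unique₂

  toFibre : ∀ {T} (h : T ⇒ Family.P) → Family.p₁ ∘ h ≈ point ∘ ! → T ⇒ D
  toFibre h p = element (Into.p₁ ∘ (Family.p₂ ∘ h))
    (begin
      dom ∘ (Into.p₁ ∘ (Family.p₂ ∘ h)) ≈⟨ assoc _ _ _ ⟨
      (dom ∘ Into.p₁) ∘ (Family.p₂ ∘ h) ≈⟨ swapˡ Family.commute ⟨
      diag ∘ (Family.p₁ ∘ h)            ≈⟨ ∘-respʳ p ⟩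
      diag ∘ (point ∘ !)                ≈⟨ pullˡ diag-point ⟩
      W.P ∘ !                           ∎)
    (trans (swapˡ Into.commute) (∘-respʳ !-unique₂))
    where open SetoidReasoning (hom-setoid _ _)

  -- A member of the family with index `⌜index⌝` is an arrow into F A from `diag` at `point`. By
  -- `diag-point` that domain is `W.P`, so the fibre is `D`.
  fibre : IsPullback 𝓑 index ⌜index⌝ include !
  fibre = record
    { commute = trans (assoc _ _ _) (trans (∘-respʳ (Family.p₁∘pair _ _ arrow-over)) (pullˡ (Over.p₁∘pair _ _ _)))
    ; pair = λ h k eq → toFibre h (over-point h k eq)
    ; p₁∘pair = λ h k eq → Family.jointly-monic
        (trans (pullˡ (Family.p₁∘pair _ _ arrow-over))
          (trans (assoc _ _ _) (trans (∘-respʳ !-unique₂) (sym (over-point h k eq)))))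
        (Into.jointly-monic (trans p₁-include arrow-element) !-unique₂)
    ; p₂∘pair = λ h k eq → !-unique₂
    ; pair-unique = λ h k eq u du≈h _ → arrow-monic
        (trans (sym p₁-include) (trans (∘-respʳ (∘-respʳ du≈h)) (sym arrow-element)))
    }

  -- `F₀ ⊤` is known here only to be terminal, so it is compared with `one` by an arrow. Taking this
  -- arrow from `□ ⊤` lets `π-□∘` compute its composite with `F₁ ⌜index⌝`.
  ι : GlobalArrow one (F₀ ⊤)
  ι = record
    { arr = π ⊤ ∘ unit
    ; dom-arr = trans (dom-π∘ ⊤) (trans (∘-respʳ !-unique₂) (identityʳ one))
    ; cod-arr = trans (cod-π∘ ⊤) (trans (∘-respʳ !-unique₂) (identityʳ (F₀ ⊤)))
    }

  -- On arrows in the image of F, `ℍ` agrees with `□#`: the code of F index is F applied to its name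
  -- `⌜index⌝`.
  quoted-factors : quoted ΓC.≈ F₁ ⌜index⌝ ΓC.∘ ι
  quoted-factors = begin
    π C₁ ∘ (H₁ ∘ ⌜index⌝)      ≈⟨ ∘-respʳ (ℍ-F₁ index) ⟩
    π C₁ ∘ (□₁ ⌜index⌝ ∘ unit) ≈⟨ π-□∘ ⌜index⌝ unit ⟩
    compose (π ⊤ ∘ unit) (arr (F₁ ⌜index⌝) ∘ !) _
      ≈⟨ compose-cong refl (trans (∘-respʳ !-unique₂) (identityʳ _)) ⟩
    arr (F₁ ⌜index⌝ ΓC.∘ ι)       ∎
    where open SetoidReasoning (hom-setoid _ _)

  -- Applying F to `fibre` presents F D as the pullback of F index along F `⌜index⌝`, while W is its
  -- pullback along `quoted`, which factors through the former by `quoted-factors`.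
  F-retraction : Retraction (Γ L ℂ) (F₀ D) W.P
  F-retraction = pullback-retraction (Γ L ℂ) (PreservesFiniteLimits.pullback F-preserves fibre) W.isPullback
    (PreservesFiniteLimits.terminal F-preserves isTerminal) ι quoted-factors
    (IsTerminal.! (Sections.Γ-terminal L K))

  open Retraction F-retraction

  fold : Hom (F₀ D) (F₀ A) ⇒ D
  fold = precompose retract id

  unfold : D ⇒ Hom (F₀ D) (F₀ A)
  unfold = precompose section id

  unfold-fold : unfold ∘ fold ≈ id
  unfold-fold = precompose-retract section retract isRetract

-- From geminal categories to the theorem

module _ {o ℓ e} (𝔾 : GeminalCategory o ℓ e) where
  private module P = PreGeminalCategory (GeminalCategory.preGeminal 𝔾)
  open ModalData P.modalData
  open Category 𝓑 using (refl; trans)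
  open Global 𝓑-limits ℂ

  geminal⇒modality : Modality 𝓑-limits ℂ-limits
  geminal⇒modality = record
    { F = F
    ; F-preserves = strict⇒preserves {M = 𝓑-limits} {K = ℂ-limits} {F = F} F-strict
    ; □ = □
    ; □-preserves = □-preserves
    ; π = λ A → arrow
    ; dom-π = λ A → dom-arrow
    ; cod-π = λ A → cod-arrow
    ; π-monic = λ A → arrow-monic
    ; reflect = λ A f d c → element f d c
    ; π-reflect = λ A f d c → arrow-element
    -- The congruence only exchanges one proof of composability for another.
    ; π-□ = λ f eq → trans (Sections.arrow-γ′ 𝓑-limits ℂ-limits (Functor.F₁ F f))
        (InternalCategory.compose-cong ℂ refl refl)
    ; ℍ = P.ℍ
    ; ℍ-F₀ = λ A → EqualFunctors.≈₀ P.ℍ∘F A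
    ; ℍ-F₁ = λ f → EqualFunctors.≈₁ P.ℍ∘F f
    ; σ = P.σ
    ; π-σ = P.arrow-σ
    ; σ-natural = P.σ-natural
    ; □H₁∘H₁ = _≈I_.≈₁ (GeminalCategory.□ℍ∘ℍ 𝔾)
    }

theorem6p11 : ∀ {o ℓ e} (𝔾 : GeminalCategory o ℓ e) →
  let open GeminalCategory 𝔾
      open Category 𝓑
      open FiniteLimits 𝓑-limits using (⟨_,_⟩)
      open Functor F using (F₀)
      open Global 𝓑-limits ℂ
  in (A : Obj) →
     Σ[ Y ∈ (Hom (F₀ (□₀ A)) (F₀ A) ⇒ □₀ A) ]
       Y ≈ composeHom 1ℂ (F₀ (□₀ A)) (F₀ A) ∘ ⟨ σ A ∘ Y , id ⟩
-- Maps into □A are compared as internal arrows, where `arrow-composeHom` turns composition of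
-- hom-objects into the composite in `fixedPoint-equation`.
theorem6p11 𝔾 A = Y , ΓC.arrow-monic
    (Category.trans 𝓑 (Loeb.fixedPoint-equation M A D fold unfold unfold-fold ΓC.meet)
      (Category.sym 𝓑 ΓC.arrow-composeHom))
  where
    open GeminalCategory 𝔾 using (𝓑; 𝓑-limits; ℂ)
    module ΓC = Global 𝓑-limits ℂ
    M = geminal⇒modality 𝔾
    open Diagonal M A using (D; fold; unfold; unfold-fold)
    Y = Loeb.fixedPoint M A D fold unfold unfold-fold
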